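{- Let $m \equiv 0 \pmod{4}$ be a positive integer, and let $e$ be an integer with $2 \leq e \leq \lfloor m/2\rfloor$ and $\gcd(m,e)=2$. Let $\alpha$ be a generator of $\mathbb{F}_{2^m}^*$, let $\mathcal{C}_E$ be the binary cyclic code of length $2^m-1$ with generator polynomial $\operatorname{lcm}\big(\mathbb{M}_{\alpha}(x),\mathbb{M}_{\alpha^{1+2^e}}(x)\big)$, and let $\overline{\mathcal{C}_E}$ be its extended code, with coordinates indexed by $V=\{0,1,\dots,2^m-1\}$. Then the supports of the codewords of Hamming weight $6$ in $\overline{\mathcal{C}_E}$ form a $2$-$(2^m,6,\lambda)$ design on $V$ with $$\lambda=\frac{2^{2m-3}+2^m+12}{3}.$$
   Context: $\mathbb{M}_{\beta}(x)$ denotes the minimal polynomial of $\beta\in\mathbb{F}_{2^m}$ over $\mathbb{F}_2$. A binary cyclic code of length $n$ with generator polynomial $g(x)$ is the ideal generated by $g(x)$ in $\mathbb{F}_2[x]/(x^n-1)$, identified with vectors in $\mathbb{F}_2^n$. The extended code is obtained by appending an overall parity-check coordinate (sum of all coordinates) to each codeword. The support of a codeword is the set of coordinates where it is nonzero. A $2$-$(v,k,\lambda)$ design is a pair $(V,\mathcal{B})$ with $|V|=v$ and $\mathcal{B}$ a set of $k$-subsets of $V$ such that every $2$-subset of $V$ is contained in exactly $\lambda$ members of $\mathcal{B}$. -}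

module Defs where

open import Level using (0ℓ)
open import Data.Nat using (ℕ; zero; suc; _+_; _≤_; _^_)
open import Data.Bool using (Bool; true; false; if_then_else_; _xor_; _∧_)
open import Data.List using (List; []; _∷_; length; filter)
open import Data.Vec using (Vec; []; _∷_; _∷ʳ_; last; init; replicate; zipWith)
open import Data.Fin using (Fin)
open import Data.Fin.Subset using (Subset; ∣_∣) renaming (_∈_ to _∈ₛ_)
open import Data.Fin.Subset.Properties using () renaming (_∈?_ to _∈ₛ?_)
open import Data.Product using (Σ; ∃; _×_; _,_)
open import Relation.Nullary using (¬_)
open import Relation.Nullary.Decidable using (_×-dec_)
open import Relation.Binary.PropositionalEquality using (_≡_; _≢_)
open import Algebra.Structures using (IsCommutativeRing)
open import Function.Bundles using (_↔_; _⇔_)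
import Data.List.Membership.Propositional as LMem
open import Data.List.Relation.Unary.Unique.Propositional using (Unique)

-- The finite field F_{2^m}: a commutative ring (with propositional
-- equality) in which 0 ≠ 1, every nonzero element is invertible,
-- 1 + 1 = 0 (characteristic 2), and which has exactly 2^m elements.
-- Any such structure is (isomorphic to) F_{2^m}.

record GF2^ (m : ℕ) : Set₁ where
  infixl 6 _+F_
  infixl 7 _*F_
  field
    F       : Set
    _+F_    : F → F → F
    _*F_    : F → F → F
    -F_     : F → F
    0F      : F
    1F      : F
    isCommutativeRing : IsCommutativeRing _≡_ _+F_ _*F_ -F_ 0F 1F
    0≢1     : 0F ≢ 1F
    inverse : ∀ x → x ≢ 0F → ∃ λ y → x *F y ≡ 1F
    char2   : 1F +F 1F ≡ 0F
    card    : F ↔ Fin (2 ^ m)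

  pow : F → ℕ → F
  pow x zero    = 1F
  pow x (suc i) = x *F pow x i

  IsPrimitive : F → Set
  IsPrimitive α = ∀ x → x ≢ 0F → ∃ λ i → pow α i ≡ x

-- Binary polynomials: coefficient lists, constant term first.

Poly : Set
Poly = List Bool

trim : Poly → Poly
trim [] = []
trim (b ∷ p) with trim p
... | [] = if b then true ∷ [] else []
... | q ∷ qs = b ∷ q ∷ qs

-- size p = deg p + 1 for p ≠ 0, and size 0 = 0
size : Poly → ℕ
size p = length (trim p)

padd : Poly → Poly → Poly
padd [] q = q
padd (a ∷ p) [] = a ∷ p
padd (a ∷ p) (b ∷ q) = (a xor b) ∷ padd p q

scale : Bool → Poly → Poly
scale b [] = []
scale b (a ∷ p) = (b ∧ a) ∷ scale b p

pmul : Poly → Poly → Poly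
pmul [] q = []
pmul (a ∷ p) q = padd (scale a q) (false ∷ pmul p q)

_≈P_ : Poly → Poly → Set
p ≈P q = trim p ≡ trim q

_∣P_ : Poly → Poly → Set
a ∣P b = ∃ λ c → pmul a c ≈P b

module _ {m : ℕ} (K : GF2^ m) where
  open GF2^ K

  eval : F → Poly → F
  eval β [] = 0F
  eval β (b ∷ p) = (if b then 1F else 0F) +F β *F eval β p

  -- p is the minimal polynomial of β over F_2: a nonzero (hence monic,
  -- over F_2) polynomial with root β, of least degree among such.
  IsMinPoly : F → Poly → Set
  IsMinPoly β p = (1 ≤ size p) × (eval β p ≡ 0F)
                × (∀ q → 1 ≤ size q → eval β q ≡ 0F → size p ≤ size q)

-- g is the lcm (monic, i.e. nonzero over F_2) of p and q in F_2[x]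
IsLcm : Poly → Poly → Poly → Set
IsLcm p q g = (1 ≤ size g) × p ∣P g × q ∣P g × (∀ h → p ∣P h → q ∣P h → g ∣P h)

-- Cyclic codes of length n: the ideal generated by g in F_2[x]/(x^n - 1).

-- multiplication by x modulo x^n - 1 (cyclic shift)
shift : ∀ {n} → Vec Bool n → Vec Bool n
shift {zero} v = v
shift {suc n} v = last v ∷ init v

-- reduction of a polynomial modulo x^n - 1, as a vector in F_2^n
reduce : (n : ℕ) → Poly → Vec Bool n
reduce n [] = replicate n false
reduce zero (b ∷ p) = []
reduce (suc n) (b ∷ p) = zipWith _xor_ (b ∷ replicate n false) (shift (reduce (suc n) p))

CyclicCode : (n : ℕ) → Poly → Vec Bool n → Set
CyclicCode n g c = ∃ λ h → reduce n (pmul g h) ≡ c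

parity : ∀ {n} → Vec Bool n → Bool
parity [] = false
parity (b ∷ v) = b xor parity v

Extended : (n : ℕ) → (Vec Bool n → Set) → Vec Bool (suc n) → Set
Extended n C c' = Σ (Vec Bool n) λ c → C c × (c ∷ʳ parity c ≡ c')

weight : ∀ {n} → Vec Bool n → ℕ
weight c = ∣ c ∣

support : ∀ {n} → Vec Bool n → Subset n
support c = c

record Is2Design (v k lam : ℕ) (IsBlock : Subset v → Set) : Set where
  field
    blocks   : List (Subset v)
    unique   : Unique blocks
    complete : ∀ S → (S LMem.∈ blocks) ⇔ IsBlock S
    blockSize : ∀ S → IsBlock S → ∣ S ∣ ≡ k
    balanced : ∀ x y → x ≢ y →
               length (filter (λ S → (x ∈ₛ? S) ×-dec (y ∈ₛ? S)) blocks) ≡ lam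

SupportsOfWeight : ∀ {n} → ℕ → (Vec Bool n → Set) → Subset n → Set
SupportsOfWeight {n} w C S = Σ (Vec Bool n) λ c → C c × (weight c ≡ w) × (support c ≡ S)

{-# OPTIONS --safe #-}
-- Index the coordinates by the points of F = F_{2^m} (coordinate i < 2^m − 1 is αⁱ, the
-- parity coordinate is 0) and write φ x = x^(2^e), Q x = φ x · x, B x y = φ x · y + x · φ y.
-- A word is in the extended code iff its weight is even and ∑ x = ∑ Q x = 0 over its support.
-- These conditions are invariant under affine maps, so it suffices to count the ordered
-- quadruples (a, b, c, d) which together with 0, 1 form a word.  Eliminating d = 1 + a + b + c
-- leaves B (1 + a + b) c = B (1 + a) (1 + b).  With s = 1 + a + c, t = 1 + b + c this reads
-- B s t = φ c + c, and replacing c by c + φ s · t turns it into (φ² s + s) · φ t = φ c + c.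
-- If φ² s ≠ s, each c determines t; otherwise c lies in Fix φ and t is free.  As
-- |Fix φ| = 4 and |Fix φ²| = 16, there are 2^2m + 48·2^m solutions.  Cancelling
-- repeated points in a degenerate one leaves the empty word or a word of weight 4, that is, an
-- affine Fix φ-line; removing these solutions leaves 2^2m + 8·2^m + 96 quadruples, and each
-- block through 0 and 1 arises from 24 of them.
module Submission where

open import Defs
open import Level using (0ℓ)
open import Algebra.Bundles using (CommutativeRing; RawRing)
import Algebra.Solver.Ring
open import Algebra.Solver.Ring.AlmostCommutativeRing using (fromCommutativeRing; _-Raw-AlmostCommutative⟶_)
open import Algebra.Structures using (IsCommutativeRing)
open import Data.Bool using (Bool; true; false; if_then_else_; _xor_; _∧_; not)
import Data.Bool.Properties as Bool
open import Data.Fin as Fin using (Fin; zero; suc; toℕ; fromℕ<)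
import Data.Fin.Properties as Fin
open import Data.Fin.Subset using (Subset; ∣_∣)
open import Data.Fin.Subset.Properties using (∣⊥∣≡0) renaming (_∈?_ to _∈ₛ?_)
open import Data.List using (List; []; _∷_; map; foldr; length; tabulate; filter; _++_)
open import Data.List.Membership.Propositional using (_∈_)
open import Data.List.Membership.Propositional.Properties using (∈-map⁺; ∈-map⁻; ∈-++⁺ˡ; ∈-++⁺ʳ; ∈-filter⁺; ∈-filter⁻; ∈-tabulate⁺)
open import Data.List.Properties using (length-tabulate)
open import Data.List.Relation.Unary.All as All using (All; []; _∷_)
import Data.List.Relation.Unary.All.Properties as All
open import Data.List.Relation.Unary.AllPairs using ([]; _∷_)
open import Data.List.Relation.Unary.Any using (here; there)
open import Data.List.Relation.Unary.Unique.Propositional using (Unique)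
import Data.List.Relation.Unary.Unique.Propositional.Properties as Unique
open import Data.Maybe using (Maybe; just; nothing)
open import Data.Nat using (ℕ; zero; suc; _+_; _*_; _∸_; _^_; _≤_; _<_; _/_; _%_; _!; z≤n; s≤s; s≤s⁻¹; NonZero; >-nonZero; ≢-nonZero)
open import Data.Nat.DivMod using (m≡m%n+[m/n]*n; m%n<n; m*n/n≡m; m/n≤m)
open import Data.Nat.Divisibility using (_∣_; divides; m%n≡0⇒n∣m; *-cancelˡ-∣)
open import Data.Nat.GCD using (gcd; gcd-GCD; gcd[m,n]∣n; c*gcd[m,n]≡gcd[cm,cn]; module Bézout)
open import Data.Nat.ListAction using (sum)
import Data.Nat.Properties as ℕ
open import Data.Nat.Solver using (module +-*-Solver)
open import Data.Product using (_×_; _,_; ∃; ∃₂; proj₁; proj₂)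
open import Data.Sum using (_⊎_; inj₁; inj₂)
open import Data.Vec using (Vec; []; _∷_; _∷ʳ_; replicate; zipWith; toList; initLast; lookup; _[_]≔_)
open import Data.Vec.Properties using (≡-dec; init-∷ʳ; last-∷ʳ; zipWith-identityˡ; []=⇒lookup; lookup⇒[]=; []≔-idempotent; []≔-lookup; lookup∘update; lookup∘update′; lookup-replicate; ∷-injectiveʳ)
open import Function.Bundles using (Inverse; mk⇔)
open import Function.Properties.Inverse using (↔⇒↣)
open import Relation.Binary.Definitions using (DecidableEquality; tri<; tri≈; tri>)
open import Relation.Binary.PropositionalEquality using (_≡_; _≢_; refl; sym; trans; cong; cong₂; subst; module ≡-Reasoning)
open import Relation.Nullary using (¬_; Dec; yes; no; contradiction)
open import Relation.Nullary.Decidable using (_×-dec_; via-injection)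
open import Relation.Unary using (Decidable)

-- Why the substitution for `c` works: `B s t` is the sum of `φ s · t` and `s · φ t`, and at
-- `z = φ s · t` the additive map `φ z + z` takes the value `φ² s · φ t + φ s · t`. The shift
-- therefore trades `φ s · t` for `φ² s · φ t`, after which `t` occurs only as `φ t`. Since `φ` is a
-- bijection, each fixed `s` leaves a linear equation in one unknown. The 16 elements `s` of Fix
-- `φ²` give `4 · 2^m` solutions each, all others `2^m`, whence `48 = 16 · 4 − 16`. The obstacle is
-- that Fix `φ` has four elements instead of two: words of weight 4 exist, so a solution with a
-- repeated point need not cancel to the empty word, and all such solutions have to be counted
-- exactly. Counts are natural numbers, so whatever is removed is written as a summand on the other
-- side of the equation.

private module NS = +-*-Solver

-- Finite sums

private variable
  A C : Set
  P P′ : Set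

-- Iverson bracket: counts become sums of 0/1 values, which can be swapped, reindexed and split.
⟦_⟧ : Dec P → ℕ
⟦ yes _ ⟧ = 1
⟦ no _ ⟧ = 0

⟦⟧-cong : (p : Dec P) (q : Dec P′) → (P → P′) → (P′ → P) → ⟦ p ⟧ ≡ ⟦ q ⟧
⟦⟧-cong (yes p) (yes q) f g = refl
⟦⟧-cong (yes p) (no ¬q) f g = contradiction (f p) ¬q
⟦⟧-cong (no ¬p) (yes q) f g = contradiction (g q) ¬p
⟦⟧-cong (no ¬p) (no ¬q) f g = refl

⟦⟧-yes : (p : Dec P) → P → ⟦ p ⟧ ≡ 1
⟦⟧-yes (yes _) _ = refl
⟦⟧-yes (no ¬p) p = contradiction p ¬p

⟦⟧-no : (p : Dec P) → ¬ P → ⟦ p ⟧ ≡ 0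
⟦⟧-no (yes p) ¬p = contradiction p ¬p
⟦⟧-no (no _) _ = refl

∑ : List A → (A → ℕ) → ℕ
∑ xs f = sum (map f xs)

∑-cong : (xs : List A) {f g : A → ℕ} → (∀ x → f x ≡ g x) → ∑ xs f ≡ ∑ xs g
∑-cong [] eq = refl
∑-cong (x ∷ xs) eq = cong₂ _+_ (eq x) (∑-cong xs eq)

∑-+ : (xs : List A) (f g : A → ℕ) → ∑ xs (λ x → f x + g x) ≡ ∑ xs f + ∑ xs g
∑-+ [] f g = refl
∑-+ (x ∷ xs) f g = trans (cong (f x + g x +_) (∑-+ xs f g))
  (solve 4 (λ a b c d → a :+ b :+ (c :+ d) := a :+ c :+ (b :+ d)) refl (f x) (g x) (∑ xs f) (∑ xs g))
  where open +-*-Solver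

∑-*ˡ : (xs : List A) (k : ℕ) (f : A → ℕ) → ∑ xs (λ x → k * f x) ≡ k * ∑ xs f
∑-*ˡ [] k f = sym (ℕ.*-zeroʳ k)
∑-*ˡ (x ∷ xs) k f = trans (cong (k * f x +_) (∑-*ˡ xs k f)) (sym (ℕ.*-distribˡ-+ k (f x) (∑ xs f)))

∑-const : (xs : List A) (k : ℕ) → ∑ xs (λ _ → k) ≡ length xs * k
∑-const [] k = refl
∑-const (x ∷ xs) k = cong (k +_) (∑-const xs k)

∑-zero : (xs : List A) → ∑ xs (λ _ → 0) ≡ 0
∑-zero [] = refl
∑-zero (x ∷ xs) = ∑-zero xs

∑-swap : (xs : List A) (ys : List C) (f : A → C → ℕ) →
  ∑ xs (λ x → ∑ ys (f x)) ≡ ∑ ys (λ y → ∑ xs (λ x → f x y))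
∑-swap [] ys f = sym (∑-zero ys)
∑-swap (x ∷ xs) ys f = trans (cong (∑ ys (f x) +_) (∑-swap xs ys f)) (sym (∑-+ ys (f x) _))

∑-ones : {A : Set} {f : A → ℕ} (xs : List A) → All (λ x → f x ≡ 1) xs → ∑ xs f ≡ length xs
∑-ones [] [] = refl
∑-ones (x ∷ xs) (eq ∷ eqs) = cong₂ _+_ eq (∑-ones xs eqs)

∑-cong-All : {A : Set} {f g : A → ℕ} {xs : List A} → All (λ x → f x ≡ g x) xs → ∑ xs f ≡ ∑ xs g
∑-cong-All [] = refl
∑-cong-All (eq ∷ eqs) = cong₂ _+_ eq (∑-cong-All eqs)

∑-filter : {A : Set} {P : A → Set} (P? : Decidable P) (f : A → ℕ) (xs : List A) →
  ∑ (filter P? xs) f ≡ ∑ xs (λ x → ⟦ P? x ⟧ * f x)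
∑-filter P? f [] = refl
∑-filter P? f (x ∷ xs) with P? x
... | yes _ = cong₂ _+_ (sym (ℕ.+-identityʳ (f x))) (∑-filter P? f xs)
... | no _ = ∑-filter P? f xs

length-filter-∑ : {A : Set} {P : A → Set} (P? : Decidable P) (xs : List A) →
  length (filter P? xs) ≡ ∑ xs (λ x → ⟦ P? x ⟧)
length-filter-∑ P? [] = refl
length-filter-∑ P? (x ∷ xs) with P? x
... | yes _ = cong suc (length-filter-∑ P? xs)
... | no _ = length-filter-∑ P? xs

⟦×-dec⟧ : (p : Dec P) (q : Dec P′) → ⟦ p ×-dec q ⟧ ≡ ⟦ p ⟧ * ⟦ q ⟧
⟦×-dec⟧ (yes _) (yes _) = refl
⟦×-dec⟧ (yes _) (no _) = refl
⟦×-dec⟧ (no _) _ = refl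

-- Sums over a finite type, with finitely many points left out.

module Enumerated {A : Set} (_≟_ : DecidableEquality A)
  (elems : List A) (unique : Unique elems) (complete : ∀ x → x ∈ elems) where

  ∑ₑ : (A → ℕ) → ℕ
  ∑ₑ = ∑ elems

  δ : A → A → ℕ
  δ x y = ⟦ x ≟ y ⟧

  -- The complement `1 − δ`, given by cases so that no truncated subtraction enters.
  ε : A → A → ℕ
  ε x y with x ≟ y
  ... | yes _ = 0
  ... | no _ = 1

  ε-≡ : ∀ {x y} → x ≡ y → ε x y ≡ 0
  ε-≡ {x} {y} p with x ≟ y
  ... | yes _ = refl
  ... | no ¬p = contradiction p ¬p

  ε-≢ : ∀ {x y} → x ≢ y → ε x y ≡ 1
  ε-≢ {x} {y} ¬p with x ≟ y
  ... | yes p = contradiction p ¬p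
  ... | no _ = refl

  ε-cong : ∀ {x y u v} → (x ≡ y → u ≡ v) → (u ≡ v → x ≡ y) → ε x y ≡ ε u v
  ε-cong {x} {y} f g with x ≟ y
  ... | yes p = sym (ε-≡ (f p))
  ... | no ¬p = sym (ε-≢ (λ q → ¬p (g q)))

  δ+ε≡1 : ∀ x y → δ x y + ε x y ≡ 1
  δ+ε≡1 x y with x ≟ y
  ... | yes _ = refl
  ... | no _ = refl

  δ-cong : ∀ {x y u v} → (x ≡ y → u ≡ v) → (u ≡ v → x ≡ y) → δ x y ≡ δ u v
  δ-cong {x} {y} {u} {v} = ⟦⟧-cong (x ≟ y) (u ≟ v)

  δ-≡ : ∀ {x y} → x ≡ y → δ x y ≡ 1
  δ-≡ {x} {y} = ⟦⟧-yes (x ≟ y)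

  δ-≢ : ∀ {x y} → x ≢ y → δ x y ≡ 0
  δ-≢ {x} {y} = ⟦⟧-no (x ≟ y)

  private
    ∑-δ-∉ : ∀ {a} xs (h : A → ℕ) → All (a ≢_) xs → ∑ xs (λ x → δ x a * h x) ≡ 0
    ∑-δ-∉ [] h [] = refl
    ∑-δ-∉ {a} (x ∷ xs) h (a≢x ∷ r)
      rewrite δ-≢ {x} {a} (λ x≡a → a≢x (sym x≡a)) = ∑-δ-∉ xs h r

    ∑-δ-∈ : ∀ {a} {xs} (h : A → ℕ) → Unique xs → a ∈ xs → ∑ xs (λ x → δ x a * h x) ≡ h a
    ∑-δ-∈ {a} {x ∷ xs} h (x∉ ∷ u) (here refl)
      rewrite δ-≡ {x} {a} refl | ∑-δ-∉ xs h x∉ = trans (ℕ.+-identityʳ _) (ℕ.+-identityʳ _)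
    ∑-δ-∈ {a} {x ∷ xs} h (x∉ ∷ u) (there a∈)
      rewrite δ-≢ {x} {a} (λ { refl → All.All¬⇒¬Any x∉ a∈ }) = ∑-δ-∈ h u a∈

  ∑-δ : ∀ a (h : A → ℕ) → ∑ₑ (λ x → δ x a * h x) ≡ h a
  ∑-δ a h = ∑-δ-∈ h unique (complete a)

  ∑-δ₁ : ∀ a → ∑ₑ (λ x → δ x a) ≡ 1
  ∑-δ₁ a = trans (∑-cong elems (λ x → trans (sym (ℕ.*-identityˡ _)) (ℕ.*-comm 1 (δ x a)))) (∑-δ a (λ _ → 1))

  -- Expand `h (f x)` as the sum over `y` of `δ y (f x) * h y`. After exchanging the sums,
  -- `δ y (f x)` equals `δ x (g y)`, so each `y` is met exactly once.
  ∑-bij : (f g : A → A) → (∀ x → g (f x) ≡ x) → (∀ x → f (g x) ≡ x) →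
    ∀ h → ∑ₑ (λ x → h (f x)) ≡ ∑ₑ h
  ∑-bij f g gf fg h = begin
    ∑ₑ (λ x → h (f x))
      ≡⟨ ∑-cong elems (λ x → sym (∑-δ (f x) h)) ⟩
    ∑ₑ (λ x → ∑ₑ (λ y → δ y (f x) * h y))
      ≡⟨ ∑-swap elems elems _ ⟩
    ∑ₑ (λ y → ∑ₑ (λ x → δ y (f x) * h y))
      ≡⟨ ∑-cong elems (λ y → ∑-cong elems (λ x → cong (_* h y)
           (δ-cong (λ y≡fx → trans (sym (gf x)) (cong g (sym y≡fx)))
                   (λ x≡gy → trans (sym (fg y)) (cong f (sym x≡gy)))))) ⟩
    ∑ₑ (λ y → ∑ₑ (λ x → δ x (g y) * h y))
      ≡⟨ ∑-cong elems (λ y → ∑-δ (g y) (λ _ → h y)) ⟩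
    ∑ₑ h ∎
    where open ≡-Reasoning

  -- A 0/1 weight rather than a restriction of the range: sums over new points remain sums over the
  -- whole type and can still be swapped and reindexed.
  notIn : A → List A → ℕ
  notIn x [] = 1
  notIn x (p ∷ ps) = ε x p * notIn x ps

  notIn-view : ∀ x ps → (All (x ≢_) ps) ⊎ (notIn x ps ≡ 0)
  notIn-view x [] = inj₁ []
  notIn-view x (p ∷ ps) with x ≟ p
  ... | yes _ = inj₂ refl
  ... | no x≢p with notIn-view x ps
  ...   | inj₁ all = inj₁ (x≢p ∷ all)
  ...   | inj₂ z = inj₂ (trans (ℕ.+-identityʳ _) z)

  notIn-∉ : ∀ {x ps} → All (x ≢_) ps → notIn x ps ≡ 1
  notIn-∉ [] = refl
  notIn-∉ (x≢p ∷ all) rewrite ε-≢ x≢p | notIn-∉ all = refl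

  ∑∉ : List A → (A → ℕ) → ℕ
  ∑∉ ps f = ∑ₑ (λ x → notIn x ps * f x)

  ∑∉-cong : ∀ ps {f g : A → ℕ} → (∀ x → All (x ≢_) ps → f x ≡ g x) → ∑∉ ps f ≡ ∑∉ ps g
  ∑∉-cong ps {f} {g} eq = ∑-cong elems λ x → case x (notIn-view x ps)
    where
    case : ∀ x → (All (x ≢_) ps) ⊎ (notIn x ps ≡ 0) → notIn x ps * f x ≡ notIn x ps * g x
    case x (inj₁ all) = cong (notIn x ps *_) (eq x all)
    case x (inj₂ z) = trans (cong (_* f x) z) (sym (cong (_* g x) z))

  ∑∉-+ : ∀ ps (f g : A → ℕ) → ∑∉ ps (λ x → f x + g x) ≡ ∑∉ ps f + ∑∉ ps g
  ∑∉-+ ps f g = trans (∑-cong elems λ x → ℕ.*-distribˡ-+ (notIn x ps) (f x) (g x)) (∑-+ elems _ _)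

  ∑∉-*ˡ : ∀ ps k (f : A → ℕ) → ∑∉ ps (λ x → k * f x) ≡ k * ∑∉ ps f
  ∑∉-*ˡ ps k f = trans (∑-cong elems λ x → swap (notIn x ps) (f x)) (∑-*ˡ elems k _)
    where
    swap : ∀ u v → u * (k * v) ≡ k * (u * v)
    swap u v = trans (sym (ℕ.*-assoc u k v)) (trans (cong (_* v) (ℕ.*-comm u k)) (ℕ.*-assoc k u v))

  -- One point at a time is split off by `δ + ε = 1`. Distinctness gives `notIn p ps = 1`, so `f p`
  -- comes out in full.
  ∑-delete : ∀ {ps} → Unique ps → (f : A → ℕ) → ∑ₑ f ≡ ∑∉ ps f + ∑ ps f
  ∑-delete [] f = trans (∑-cong elems (λ x → sym (ℕ.+-identityʳ (f x)))) (sym (ℕ.+-identityʳ _))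
  ∑-delete {p ∷ ps} (p∉ ∷ u) f = begin
    ∑ₑ f
      ≡⟨ ∑-delete u f ⟩
    ∑∉ ps f + ∑ ps f
      ≡⟨ cong (_+ ∑ ps f) (∑-cong elems λ x → split x) ⟩
    ∑ₑ (λ x → ε x p * notIn x ps * f x + δ x p * (notIn x ps * f x)) + ∑ ps f
      ≡⟨ cong (_+ ∑ ps f) (∑-+ elems _ _) ⟩
    ∑∉ (p ∷ ps) f + ∑ₑ (λ x → δ x p * (notIn x ps * f x)) + ∑ ps f
      ≡⟨ cong (λ t → ∑∉ (p ∷ ps) f + t + ∑ ps f) (trans (∑-δ p (λ x → notIn x ps * f x))
           (trans (cong (_* f p) (notIn-∉ p∉)) (ℕ.*-identityˡ (f p)))) ⟩
    ∑∉ (p ∷ ps) f + f p + ∑ ps f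
      ≡⟨ ℕ.+-assoc (∑∉ (p ∷ ps) f) (f p) (∑ ps f) ⟩
    ∑∉ (p ∷ ps) f + ∑ (p ∷ ps) f ∎
    where
    open ≡-Reasoning
    split : ∀ x → notIn x ps * f x ≡ ε x p * notIn x ps * f x + δ x p * (notIn x ps * f x)
    split x = begin
      t               ≡⟨ sym (ℕ.*-identityˡ t) ⟩
      1 * t           ≡⟨ cong (_* t) (sym (δ+ε≡1 x p)) ⟩
      (δ x p + ε x p) * t ≡⟨ ℕ.*-distribʳ-+ t (δ x p) (ε x p) ⟩
      δ x p * t + ε x p * t ≡⟨ ℕ.+-comm (δ x p * t) (ε x p * t) ⟩
      ε x p * t + δ x p * t ≡⟨ cong (_+ δ x p * t) (sym (ℕ.*-assoc (ε x p) (notIn x ps) (f x))) ⟩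
      ε x p * notIn x ps * f x + δ x p * t ∎
      where t = notIn x ps * f x

-- Binary polynomials

coef : Poly → ℕ → Bool
coef [] i = false
coef (b ∷ p) zero = b
coef (b ∷ p) (suc i) = coef p i

-- Insensitive to trailing zeros like `_≈P_`, but provable one coefficient at a time.
_≐_ : Poly → Poly → Set
p ≐ q = ∀ i → coef p i ≡ coef q i

-- The case split inside `trim`, made a function so that `trim` of a cons can be rewritten.
ncons : Bool → Poly → Poly
ncons b [] = if b then true ∷ [] else []
ncons b (q ∷ qs) = b ∷ q ∷ qs

trim-∷ : ∀ b p → trim (b ∷ p) ≡ ncons b (trim p)
trim-∷ b p with trim p
... | [] = refl
... | q ∷ qs = refl

coef-ncons : ∀ b p i → coef (ncons b p) i ≡ coef (b ∷ p) i
coef-ncons false [] zero = refl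
coef-ncons false [] (suc i) = refl
coef-ncons true [] i = refl
coef-ncons b (q ∷ qs) i = refl

coef-trim : ∀ p → trim p ≐ p
coef-trim [] i = refl
coef-trim (b ∷ p) i rewrite trim-∷ b p = trans (coef-ncons b (trim p) i) (tail i)
  where
  tail : (b ∷ trim p) ≐ (b ∷ p)
  tail zero = refl
  tail (suc i) = coef-trim p i

≈P⇒≐ : ∀ p q → p ≈P q → p ≐ q
≈P⇒≐ p q eq i = trans (sym (coef-trim p i)) (trans (cong (λ t → coef t i) eq) (coef-trim q i))

trim-zero : ∀ p → p ≐ [] → trim p ≡ []
trim-zero [] z = refl
trim-zero (b ∷ p) z rewrite trim-∷ b p | trim-zero p (λ i → z (suc i)) | z 0 = refl

≐⇒≈P : ∀ p q → p ≐ q → p ≈P q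
≐⇒≈P [] q eq = sym (trim-zero q (λ i → sym (eq i)))
≐⇒≈P (b ∷ p) [] eq = trim-zero (b ∷ p) eq
≐⇒≈P (b ∷ p) (c ∷ q) eq rewrite trim-∷ b p | trim-∷ c q =
  cong₂ ncons (eq 0) (≐⇒≈P p q (λ i → eq (suc i)))

coef-≥length : ∀ p {i} → length p ≤ i → coef p i ≡ false
coef-≥length [] _ = refl
coef-≥length (b ∷ p) (s≤s le) = coef-≥length p le

size≤⇒coef : ∀ p {k i} → size p ≤ k → k ≤ i → coef p i ≡ false
size≤⇒coef p {i = i} s≤k k≤i = trans (sym (coef-trim p i)) (coef-≥length (trim p) (ℕ.≤-trans s≤k k≤i))

coef⇒size≤ : ∀ p {k} → (∀ i → k ≤ i → coef p i ≡ false) → size p ≤ k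
coef⇒size≤ p {zero} z rewrite trim-zero p (λ i → z i z≤n) = z≤n
coef⇒size≤ [] {suc k} z = z≤n
coef⇒size≤ (b ∷ p) {suc k} z rewrite trim-∷ b p =
  ncons-≤ b (trim p) (coef⇒size≤ p (λ i k≤i → z (suc i) (s≤s k≤i)))
  where
  ncons-≤ : ∀ b q → length q ≤ k → length (ncons b q) ≤ suc k
  ncons-≤ true [] _ = s≤s z≤n
  ncons-≤ false [] _ = z≤n
  ncons-≤ b (_ ∷ _) le = s≤s le

coef-padd : ∀ p q i → coef (padd p q) i ≡ coef p i xor coef q i
coef-padd [] q i = refl
coef-padd (a ∷ p) [] i = sym (Bool.xor-identityʳ _)
coef-padd (a ∷ p) (b ∷ q) zero = refl
coef-padd (a ∷ p) (b ∷ q) (suc i) = coef-padd p q i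

coef-scale : ∀ b p i → coef (scale b p) i ≡ b ∧ coef p i
coef-scale b [] i = sym (Bool.∧-zeroʳ b)
coef-scale b (a ∷ p) zero = refl
coef-scale b (a ∷ p) (suc i) = coef-scale b p i

coef-pmul-zero : ∀ a p q → coef (pmul (a ∷ p) q) 0 ≡ a ∧ coef q 0
coef-pmul-zero a p q = trans (coef-padd (scale a q) _ 0) (trans (Bool.xor-identityʳ _) (coef-scale a q 0))

coef-pmul-suc : ∀ a p q i → coef (pmul (a ∷ p) q) (suc i) ≡ (a ∧ coef q (suc i)) xor coef (pmul p q) i
coef-pmul-suc a p q i = trans (coef-padd (scale a q) _ (suc i)) (cong (_xor _) (coef-scale a q (suc i)))

pmul-shift : ∀ p c → pmul p (false ∷ c) ≐ (false ∷ pmul p c)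
pmul-shift [] c zero = refl
pmul-shift [] c (suc i) = refl
pmul-shift (a ∷ p) c zero = trans (coef-pmul-zero a p (false ∷ c)) (Bool.∧-zeroʳ a)
pmul-shift (a ∷ p) c (suc zero) =
  trans (coef-pmul-suc a p (false ∷ c) 0) (trans (cong ((a ∧ coef c 0) xor_) (pmul-shift p c 0))
  (trans (Bool.xor-identityʳ _) (sym (coef-pmul-zero a p c))))
pmul-shift (a ∷ p) c (suc (suc i)) =
  trans (coef-pmul-suc a p (false ∷ c) (suc i)) (trans (cong ((a ∧ coef c (suc i)) xor_) (pmul-shift p c (suc i)))
  (sym (coef-pmul-suc a p c i)))

pmul-one : ∀ p → pmul p (true ∷ []) ≐ p
pmul-one [] i = refl
pmul-one (a ∷ p) zero = trans (coef-pmul-zero a p (true ∷ [])) (Bool.∧-identityʳ a)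
pmul-one (a ∷ p) (suc i) = trans (coef-pmul-suc a p (true ∷ []) i) (trans (cong (_xor coef (pmul p (true ∷ [])) i) (Bool.∧-zeroʳ a)) (pmul-one p i))

xor-interchange : ∀ a b c d → (a xor b) xor (c xor d) ≡ (a xor c) xor (b xor d)
xor-interchange a b c d = trans (Bool.xor-assoc a b _) (trans (cong (a xor_)
  (trans (sym (Bool.xor-assoc b c d)) (trans (cong (_xor d) (Bool.xor-comm b c)) (Bool.xor-assoc c b d)))) (sym (Bool.xor-assoc a c _)))

pmul-distrib : ∀ p c d i → coef (pmul p (padd c d)) i ≡ coef (pmul p c) i xor coef (pmul p d) i
pmul-distrib [] c d i = refl
pmul-distrib (a ∷ p) c d zero
  rewrite coef-pmul-zero a p (padd c d) | coef-pmul-zero a p c | coef-pmul-zero a p d | coef-padd c d 0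
  = Bool.∧-distribˡ-xor a (coef c 0) (coef d 0)
pmul-distrib (a ∷ p) c d (suc i)
  rewrite coef-pmul-suc a p (padd c d) i | coef-pmul-suc a p c i | coef-pmul-suc a p d i
        | coef-padd c d (suc i) | pmul-distrib p c d i | Bool.∧-distribˡ-xor a (coef c (suc i)) (coef d (suc i))
  = xor-interchange (a ∧ coef c (suc i)) (a ∧ coef d (suc i)) (coef (pmul p c) i) (coef (pmul p d) i)

pmul-zeroʳ : ∀ p → pmul p [] ≐ []
pmul-zeroʳ [] i = refl
pmul-zeroʳ (a ∷ p) zero = refl
pmul-zeroʳ (a ∷ p) (suc i) = pmul-zeroʳ p i

-- Division with remainder.

leading-coef : ∀ p {k} → size p ≡ suc k → coef p k ≡ true
leading-coef p {k} sz with coef p k in eq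
... | true = refl
... | false = contradiction (coef⇒size≤ p above) (ℕ.<⇒≱ (subst (k <_) (sym sz) ℕ.≤-refl))
  where
  above : ∀ i → k ≤ i → coef p i ≡ false
  above i k≤i with ℕ.m≤n⇒m<n∨m≡n k≤i
  ... | inj₁ k<i = size≤⇒coef p {suc k} (subst (_≤ suc k) (sym sz) ℕ.≤-refl) k<i
  ... | inj₂ refl = eq

-- Lists begin with the constant term, so the induction strips the lowest coefficient: `q = p c + r`
-- gives `b + x q = p (x c) + (b + x r)`. The degree of `b + x r` is at most that of `p`, and one
-- more subtraction of `p` is due exactly when its coefficient at `k` is 1.
division : ∀ p {k} → size p ≡ suc k → ∀ q → ∃₂ λ c r → padd (pmul p c) r ≐ q × size r ≤ k
division p sz [] = [] , [] , (λ i → trans (coef-padd (pmul p []) [] i) (trans (Bool.xor-identityʳ _) (pmul-zeroʳ p i))) , z≤n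
division p {k} sz (b ∷ q) with division p sz q
... | c , r , eq , r≤k with coef (b ∷ r) k in lead
... | false = false ∷ c , b ∷ r , eq' , coef⇒size≤ (b ∷ r) small
  where
  eq' : padd (pmul p (false ∷ c)) (b ∷ r) ≐ (b ∷ q)
  eq' i = trans (coef-padd (pmul p (false ∷ c)) (b ∷ r) i) (trans (cong (_xor _) (pmul-shift p c i)) (body i))
    where
    body : ∀ i → coef (false ∷ pmul p c) i xor coef (b ∷ r) i ≡ coef (b ∷ q) i
    body zero = refl
    body (suc i) = trans (sym (coef-padd (pmul p c) r i)) (eq i)
  small : ∀ i → k ≤ i → coef (b ∷ r) i ≡ false
  small i k≤i with ℕ.m≤n⇒m<n∨m≡n k≤i
  ... | inj₁ (s≤s k≤j) = size≤⇒coef r r≤k k≤j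
  ... | inj₂ refl = lead
... | true = padd (false ∷ c) (true ∷ []) , padd p (b ∷ r) , eq' , coef⇒size≤ (padd p (b ∷ r)) small
  where
  eq' : padd (pmul p (padd (false ∷ c) (true ∷ []))) (padd p (b ∷ r)) ≐ (b ∷ q)
  eq' i rewrite coef-padd (pmul p (padd (false ∷ c) (true ∷ []))) (padd p (b ∷ r)) i
              | pmul-distrib p (false ∷ c) (true ∷ []) i
              | coef-padd p (b ∷ r) i | pmul-one p i | pmul-shift p c i
    = trans (cancel (coef (false ∷ pmul p c) i) (coef p i) (coef (b ∷ r) i)) (body i)
    where
    cancel : ∀ x y z → (x xor y) xor (y xor z) ≡ x xor z
    cancel x y z = trans (Bool.xor-assoc x y _) (cong (x xor_) (trans (sym (Bool.xor-assoc y y z)) (cong (_xor z) (Bool.xor-same y))))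
    body : ∀ i → coef (false ∷ pmul p c) i xor coef (b ∷ r) i ≡ coef (b ∷ q) i
    body zero = refl
    body (suc i) = trans (sym (coef-padd (pmul p c) r i)) (eq i)
  small : ∀ i → k ≤ i → coef (padd p (b ∷ r)) i ≡ false
  small i k≤i with ℕ.m≤n⇒m<n∨m≡n k≤i
  ... | inj₁ (s≤s k≤j) = trans (coef-padd p (b ∷ r) i) (cong₂ _xor_
          (size≤⇒coef p {suc k} (subst (_≤ suc k) (sym sz) ℕ.≤-refl) (s≤s k≤j)) (size≤⇒coef r r≤k k≤j))
  ... | inj₂ refl = trans (coef-padd p (b ∷ r) i) (cong₂ _xor_ (leading-coef p sz) lead)

-- Reduction modulo x^n - 1.

pad : ∀ n → Poly → Vec Bool n
pad zero p = []
pad (suc n) [] = false ∷ pad n []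
pad (suc n) (b ∷ p) = b ∷ pad n p

pad-[] : ∀ n → pad n [] ≡ replicate n false
pad-[] zero = refl
pad-[] (suc n) = cong (false ∷_) (pad-[] n)

pad-toList : ∀ {n} (v : Vec Bool n) → pad n (toList v) ≡ v
pad-toList [] = refl
pad-toList (b ∷ v) = cong (b ∷_) (pad-toList v)

-- Exposes the `false` that the cyclic shift moves to the front: a product with x that still fits
-- does not wrap round.
pad-∷ʳ : ∀ n p → length p ≤ n → pad (suc n) p ≡ pad n p ∷ʳ false
pad-∷ʳ zero [] _ = refl
pad-∷ʳ (suc n) [] _ = cong (false ∷_) (pad-∷ʳ n [] z≤n)
pad-∷ʳ (suc n) (b ∷ p) (s≤s le) = cong (b ∷_) (pad-∷ʳ n p le)

reduce-short : ∀ n p → length p ≤ n → reduce n p ≡ pad n p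
reduce-short n [] _ = sym (pad-[] n)
reduce-short (suc n) (b ∷ p) (s≤s le)
  rewrite reduce-short (suc n) p (ℕ.≤-trans le (ℕ.n≤1+n n)) | pad-∷ʳ n p le
        | last-∷ʳ false (pad n p) | init-∷ʳ false (pad n p) | Bool.xor-identityʳ b
  = cong (b ∷_) (zipWith-identityˡ (λ _ → refl) (pad n p))

reduce-toList : ∀ {n} (v : Vec Bool n) → reduce n (toList v) ≡ v
reduce-toList {n} v = trans (reduce-short n (toList v) (length≤ v)) (pad-toList v)
  where
  length≤ : ∀ {n} (v : Vec Bool n) → length (toList v) ≤ n
  length≤ [] = z≤n
  length≤ (_ ∷ v) = s≤s (length≤ v)

reduce-false∷[] : ∀ n → reduce n (false ∷ []) ≡ replicate n false
reduce-false∷[] zero = refl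
reduce-false∷[] (suc n) = trans (reduce-short (suc n) (false ∷ []) (s≤s z≤n)) (cong (false ∷_) (pad-[] n))

-- Divisibility is stated up to trailing zeros, so `reduce` must ignore them before a cofactor of
-- `g` yields a codeword.
reduce-trim : ∀ n p → reduce n (trim p) ≡ reduce n p
reduce-trim n [] = refl
reduce-trim n (b ∷ p) rewrite trim-∷ b p = trans (ncons-∷ b (trim p)) (tail n)
  where
  ncons-∷ : ∀ b q → reduce n (ncons b q) ≡ reduce n (b ∷ q)
  ncons-∷ true [] = refl
  ncons-∷ false [] = sym (reduce-false∷[] n)
  ncons-∷ b (_ ∷ _) = refl
  tail : ∀ n → reduce n (b ∷ trim p) ≡ reduce n (b ∷ p)
  tail zero = refl
  tail (suc n) rewrite reduce-trim (suc n) p = refl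

-- Fields of characteristic 2

module Field {m : ℕ} (K : GF2^ m) where
  open GF2^ K public
  open IsCommutativeRing isCommutativeRing public
    using (+-identityˡ; +-identityʳ; +-comm; +-assoc; *-identityˡ; *-identityʳ; *-comm; *-assoc; zeroˡ; zeroʳ; distribˡ; distribʳ)

  bit : Bool → F
  bit b = if b then 1F else 0F

  private
    ring : CommutativeRing 0ℓ 0ℓ
    ring = record { isCommutativeRing = isCommutativeRing }

    neg-1 : -F 1F ≡ 1F
    neg-1 = begin
      -F 1F                     ≡⟨ sym (+-identityʳ _) ⟩
      -F 1F +F 0F               ≡⟨ cong (-F 1F +F_) (sym char2) ⟩
      -F 1F +F (1F +F 1F)       ≡⟨ sym (+-assoc _ _ _) ⟩
      (-F 1F +F 1F) +F 1F       ≡⟨ cong (_+F 1F) (IsCommutativeRing.-‿inverseˡ isCommutativeRing 1F) ⟩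
      0F +F 1F                  ≡⟨ +-identityˡ 1F ⟩
      1F                        ∎
      where open ≡-Reasoning

    neg-0 : -F 0F ≡ 0F
    neg-0 = trans (sym (+-identityʳ _)) (IsCommutativeRing.-‿inverseˡ isCommutativeRing 0F)

    -- Coefficients in F₂, so that the solver proves identities of characteristic 2.
    F₂ : RawRing 0ℓ 0ℓ
    F₂ = record { Carrier = Bool ; _≈_ = _≡_ ; _+_ = _xor_ ; _*_ = _∧_ ; -_ = λ b → b ; 0# = false ; 1# = true }

    bit-xor : ∀ a b → bit (a xor b) ≡ bit a +F bit b
    bit-xor false b = sym (+-identityˡ _)
    bit-xor true false = sym (+-identityʳ _)
    bit-xor true true = sym char2

    bit-∧ : ∀ a b → bit (a ∧ b) ≡ bit a *F bit b
    bit-∧ false b = sym (zeroˡ _)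
    bit-∧ true b = sym (*-identityˡ _)

    embed : F₂ -Raw-AlmostCommutative⟶ fromCommutativeRing ring
    embed = record
      { ⟦_⟧ = bit
      ; +-homo = bit-xor
      ; *-homo = bit-∧
      ; -‿homo = λ { false → sym neg-0 ; true → sym neg-1 }
      ; 0-homo = refl
      ; 1-homo = refl
      }

    coeff≟ : ∀ a b → Maybe (bit a ≡ bit b)
    coeff≟ false false = just refl
    coeff≟ true true = just refl
    coeff≟ _ _ = nothing

  open Algebra.Solver.Ring F₂ (fromCommutativeRing ring) embed coeff≟ public
    using (solve; _:=_; _:+_; _:*_; con; Polynomial)

  :0 :1 : ∀ {n} → Polynomial n
  :0 = con false
  :1 = con true

  abstract
    -- Opaque, so that comparing field elements never unfolds into `card`.
    _≟F_ : DecidableEquality F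
    _≟F_ = via-injection (↔⇒↣ card) Fin._≟_

  x+x≡0 : ∀ x → x +F x ≡ 0F
  x+x≡0 = solve 1 (λ x → x :+ x := :0) refl

  -- In characteristic 2 a sum is also a difference, so equations with equal sums are equivalent,
  -- and the ring solver only has to compare the sums.
  by-sum : ∀ {x y u v} → x +F y ≡ u +F v → u ≡ v → x ≡ y
  by-sum {x} {y} {u} eq refl = begin
    x               ≡⟨ solve 2 (λ x y → x := (x :+ y) :+ y) refl x y ⟩
    (x +F y) +F y   ≡⟨ cong (_+F y) (trans eq (x+x≡0 u)) ⟩
    0F +F y         ≡⟨ +-identityˡ y ⟩
    y               ∎
    where open ≡-Reasoning

  infix 8 _⁻¹⟨_⟩
  _⁻¹⟨_⟩ : ∀ x → x ≢ 0F → F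
  x ⁻¹⟨ nz ⟩ = proj₁ (inverse x nz)

  *-inverseʳ : ∀ {x} (nz : x ≢ 0F) → x *F x ⁻¹⟨ nz ⟩ ≡ 1F
  *-inverseʳ nz = proj₂ (inverse _ nz)

  inverse-cancelˡ : ∀ {x} (nz : x ≢ 0F) y → x ⁻¹⟨ nz ⟩ *F (x *F y) ≡ y
  inverse-cancelˡ {x} nz y = begin
    x ⁻¹⟨ nz ⟩ *F (x *F y)  ≡⟨ solve 3 (λ i x y → i :* (x :* y) := x :* i :* y) refl (x ⁻¹⟨ nz ⟩) x y ⟩
    x *F x ⁻¹⟨ nz ⟩ *F y    ≡⟨ cong (_*F y) (*-inverseʳ nz) ⟩
    1F *F y                 ≡⟨ *-identityˡ y ⟩
    y                       ∎
    where open ≡-Reasoning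

  inverse-cancelʳ : ∀ {x} (nz : x ≢ 0F) y → x *F (x ⁻¹⟨ nz ⟩ *F y) ≡ y
  inverse-cancelʳ {x} nz y =
    trans (solve 3 (λ i x y → x :* (i :* y) := i :* (x :* y)) refl (x ⁻¹⟨ nz ⟩) x y) (inverse-cancelˡ nz y)

  *-cancelˡ : ∀ {x y z} → x ≢ 0F → x *F y ≡ x *F z → y ≡ z
  *-cancelˡ {x} {y} {z} nz eq =
    trans (sym (inverse-cancelˡ nz y)) (trans (cong (x ⁻¹⟨ nz ⟩ *F_) eq) (inverse-cancelˡ nz z))

  *-nonzero : ∀ {x y} → x ≢ 0F → y ≢ 0F → x *F y ≢ 0F
  *-nonzero {x} nx ny eq = ny (*-cancelˡ nx (trans eq (sym (zeroʳ x))))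

  pow-+ : ∀ x i j → pow x (i + j) ≡ pow x i *F pow x j
  pow-+ x zero j = sym (*-identityˡ _)
  pow-+ x (suc i) j = trans (cong (x *F_) (pow-+ x i j)) (sym (*-assoc _ _ _))

  pow-* : ∀ x i j → pow x (i * j) ≡ pow (pow x j) i
  pow-* x zero j = refl
  pow-* x (suc i) j = trans (pow-+ x j (i * j)) (cong (pow x j *F_) (pow-* x i j))

  pow-pow-comm : ∀ x i j → pow (pow x i) j ≡ pow (pow x j) i
  pow-pow-comm x i j = trans (sym (pow-* x j i)) (trans (cong (pow x) (ℕ.*-comm j i)) (pow-* x i j))

  pow-*-distrib : ∀ x y i → pow (x *F y) i ≡ pow x i *F pow y i
  pow-*-distrib x y zero = sym (*-identityˡ _)
  pow-*-distrib x y (suc i) = trans (cong (x *F y *F_) (pow-*-distrib x y i))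
    (solve 4 (λ x y a b → x :* y :* (a :* b) := x :* a :* (y :* b)) refl x y (pow x i) (pow y i))

  pow-1F : ∀ i → pow 1F i ≡ 1F
  pow-1F zero = refl
  pow-1F (suc i) = trans (*-identityˡ _) (pow-1F i)

  pow-nonzero : ∀ {x} i → x ≢ 0F → pow x i ≢ 0F
  pow-nonzero zero nz eq = 0≢1 (sym eq)
  pow-nonzero (suc i) nz = *-nonzero nz (pow-nonzero i nz)

  sq : F → F
  sq x = x *F x

  frob : ℕ → F → F
  frob zero x = x
  frob (suc k) x = sq (frob k x)

  frob-pow : ∀ k x → frob k x ≡ pow x (2 ^ k)
  frob-pow zero x = sym (*-identityʳ x)
  frob-pow (suc k) x = begin
    sq (frob k x)                     ≡⟨ cong sq (frob-pow k x) ⟩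
    pow x (2 ^ k) *F pow x (2 ^ k)    ≡⟨ sym (pow-+ x (2 ^ k) (2 ^ k)) ⟩
    pow x (2 ^ k + 2 ^ k)             ≡⟨ cong (λ t → pow x (2 ^ k + t)) (sym (ℕ.+-identityʳ (2 ^ k))) ⟩
    pow x (2 ^ suc k)                 ∎
    where open ≡-Reasoning

  frob-+F : ∀ k x y → frob k (x +F y) ≡ frob k x +F frob k y
  frob-+F zero x y = refl
  frob-+F (suc k) x y = trans (cong sq (frob-+F k x y))
    (solve 2 (λ a b → (a :+ b) :* (a :+ b) := a :* a :+ b :* b) refl (frob k x) (frob k y))

  frob-*F : ∀ k x y → frob k (x *F y) ≡ frob k x *F frob k y
  frob-*F zero x y = refl
  frob-*F (suc k) x y = trans (cong sq (frob-*F k x y))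
    (solve 2 (λ a b → (a :* b) :* (a :* b) := a :* a :* (b :* b)) refl (frob k x) (frob k y))

  frob-∘ : ∀ j k x → frob j (frob k x) ≡ frob (j + k) x
  frob-∘ zero k x = refl
  frob-∘ (suc j) k x = cong sq (frob-∘ j k x)

  frob-comm : ∀ j k x → frob j (frob k x) ≡ frob k (frob j x)
  frob-comm j k x = trans (frob-∘ j k x) (trans (cong (λ t → frob t x) (ℕ.+-comm j k)) (sym (frob-∘ k j x)))

  frob-multiple : ∀ j k {x} → frob k x ≡ x → frob (j * k) x ≡ x
  frob-multiple zero k eq = refl
  frob-multiple (suc j) k {x} eq =
    trans (sym (frob-∘ k (j * k) x)) (trans (cong (frob k) (frob-multiple j k eq)) eq)

  -- Evaluation, and cyclic codes described by their zeros.

  eval-padd : ∀ β p q → eval K β (padd p q) ≡ eval K β p +F eval K β q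
  eval-padd β [] q = sym (+-identityˡ _)
  eval-padd β (a ∷ p) [] = sym (+-identityʳ _)
  eval-padd β (a ∷ p) (b ∷ q) = trans (cong₂ (λ s t → s +F β *F t) (bit-xor a b) (eval-padd β p q))
    (solve 5 (λ x a b p q → a :+ b :+ x :* (p :+ q) := a :+ x :* p :+ (b :+ x :* q)) refl
      β (bit a) (bit b) (eval K β p) (eval K β q))

  eval-scale : ∀ β a p → eval K β (scale a p) ≡ bit a *F eval K β p
  eval-scale β a [] = sym (zeroʳ _)
  eval-scale β a (b ∷ p) = trans (cong₂ (λ s t → s +F β *F t) (bit-∧ a b) (eval-scale β a p))
    (solve 4 (λ x a b p → a :* b :+ x :* (a :* p) := a :* (b :+ x :* p)) refl β (bit a) (bit b) (eval K β p))

  eval-pmul : ∀ β p q → eval K β (pmul p q) ≡ eval K β p *F eval K β q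
  eval-pmul β [] q = sym (zeroˡ _)
  eval-pmul β (a ∷ p) q = begin
    eval K β (padd (scale a q) (false ∷ pmul p q))
      ≡⟨ eval-padd β (scale a q) (false ∷ pmul p q) ⟩
    eval K β (scale a q) +F (0F +F β *F eval K β (pmul p q))
      ≡⟨ cong₂ (λ s t → s +F (0F +F β *F t)) (eval-scale β a q) (eval-pmul β p q) ⟩
    bit a *F eval K β q +F (0F +F β *F (eval K β p *F eval K β q))
      ≡⟨ solve 4 (λ x a p q → a :* q :+ (:0 :+ x :* (p :* q)) := (a :+ x :* p) :* q) refl
           β (bit a) (eval K β p) (eval K β q) ⟩
    (bit a +F β *F eval K β p) *F eval K β q ∎
    where open ≡-Reasoning

  eval-zero : ∀ β p → p ≐ [] → eval K β p ≡ 0F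
  eval-zero β [] z = refl
  eval-zero β (b ∷ p) z rewrite z 0 | eval-zero β p (λ i → z (suc i)) = trans (+-identityˡ _) (zeroʳ β)

  eval-≐ : ∀ β p q → p ≐ q → eval K β p ≡ eval K β q
  eval-≐ β [] q eq = sym (eval-zero β q (λ i → sym (eq i)))
  eval-≐ β (b ∷ p) [] eq = eval-zero β (b ∷ p) eq
  eval-≐ β (b ∷ p) (c ∷ q) eq =
    cong₂ (λ s t → bit s +F β *F t) (eq 0) (eval-≐ β p q (λ i → eq (suc i)))

  -- The remainder of `q` modulo `p` vanishes at `β` too and is shorter than `p`, so minimality
  -- forces it to be zero.
  minPoly-∣ : ∀ β p → IsMinPoly K β p → ∀ q → eval K β q ≡ 0F → p ∣P q
  minPoly-∣ β p (1≤p , pβ≡0 , least) q qβ≡0 with size p in sz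
  minPoly-∣ β p (() , pβ≡0 , least) q qβ≡0 | zero
  ... | suc k with division p sz q
  ... | c , r , eq , r≤k = c , ≐⇒≈P (pmul p c) q λ i →
          trans (trans (sym (Bool.xor-identityʳ _)) (cong (coef (pmul p c) i xor_) (sym (r≐0 i))))
                (trans (sym (coef-padd (pmul p c) r i)) (eq i))
    where
    rβ≡0 : eval K β r ≡ 0F
    rβ≡0 = begin
      eval K β r                                 ≡⟨ sym (+-identityˡ _) ⟩
      0F +F eval K β r                           ≡⟨ cong (_+F eval K β r) (sym (zeroˡ _)) ⟩
      0F *F eval K β c +F eval K β r             ≡⟨ cong (λ t → t *F eval K β c +F eval K β r) (sym pβ≡0) ⟩
      eval K β p *F eval K β c +F eval K β r     ≡⟨ cong (_+F eval K β r) (sym (eval-pmul β p c)) ⟩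
      eval K β (pmul p c) +F eval K β r          ≡⟨ sym (eval-padd β (pmul p c) r) ⟩
      eval K β (padd (pmul p c) r)               ≡⟨ eval-≐ β (padd (pmul p c) r) q eq ⟩
      eval K β q                                 ≡⟨ qβ≡0 ⟩
      0F ∎
      where open ≡-Reasoning
    r≐0 : r ≐ []
    r≐0 i with 1 ℕ.≤? size r
    ... | yes 1≤r = contradiction r≤k (ℕ.<⇒≱ (least r 1≤r rβ≡0))
    ... | no 1≰r = size≤⇒coef r (ℕ.≤-pred (ℕ.≰⇒> 1≰r)) z≤n

  root-∣ : ∀ β p g → eval K β p ≡ 0F → p ∣P g → eval K β g ≡ 0F
  root-∣ β p g pβ≡0 (c , pc≈g) = begin
    eval K β g                 ≡⟨ sym (eval-≐ β (pmul p c) g (≈P⇒≐ (pmul p c) g pc≈g)) ⟩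
    eval K β (pmul p c)        ≡⟨ eval-pmul β p c ⟩
    eval K β p *F eval K β c   ≡⟨ cong (_*F eval K β c) pβ≡0 ⟩
    0F *F eval K β c           ≡⟨ zeroˡ _ ⟩
    0F ∎
    where open ≡-Reasoning

  -- For `w = pow β` this is the polynomial of the word evaluated at `β`. General weights also cover
  -- the extended word, whose last coordinate is no power of `α`.
  fsum : ∀ {n} → (ℕ → F) → Vec Bool n → F
  fsum w [] = 0F
  fsum w (b ∷ v) = bit b *F w 0 +F fsum (λ i → w (suc i)) v

  fsum-∷ʳ : ∀ {n} w (v : Vec Bool n) b → fsum w (v ∷ʳ b) ≡ fsum w v +F bit b *F w n
  fsum-∷ʳ w [] b = trans (+-identityʳ _) (sym (+-identityˡ _))
  fsum-∷ʳ w (a ∷ v) b = trans (cong (bit a *F w 0 +F_) (fsum-∷ʳ (λ i → w (suc i)) v b)) (sym (+-assoc _ _ _))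

  fsum-cong : ∀ {n} {w w' : ℕ → F} → (∀ i → i < n → w i ≡ w' i) → (v : Vec Bool n) → fsum w v ≡ fsum w' v
  fsum-cong eq [] = refl
  fsum-cong eq (b ∷ v) = cong₂ _+F_ (cong (bit b *F_) (eq 0 (s≤s z≤n))) (fsum-cong (λ i i<n → eq (suc i) (s≤s i<n)) v)

  fsum-xor : ∀ {n} w (u v : Vec Bool n) → fsum w (zipWith _xor_ u v) ≡ fsum w u +F fsum w v
  fsum-xor w [] [] = sym (+-identityˡ _)
  fsum-xor w (a ∷ u) (b ∷ v) = trans (cong₂ (λ s t → s *F w 0 +F t) (bit-xor a b) (fsum-xor (λ i → w (suc i)) u v))
    (solve 5 (λ a b x p q → (a :+ b) :* x :+ (p :+ q) := a :* x :+ p :+ (b :* x :+ q)) refl (bit a) (bit b) (w 0) _ _)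

  fsum-false : ∀ n w → fsum w (replicate n false) ≡ 0F
  fsum-false zero w = refl
  fsum-false (suc n) w = trans (cong₂ _+F_ (zeroˡ _) (fsum-false n _)) (+-identityˡ _)

  fsum-scale : ∀ {n} β w (v : Vec Bool n) → fsum (λ i → β *F w i) v ≡ β *F fsum w v
  fsum-scale β w [] = sym (zeroʳ β)
  fsum-scale β w (b ∷ v) = trans (cong (bit b *F (β *F w 0) +F_) (fsum-scale β (λ i → w (suc i)) v))
    (solve 4 (λ x b a s → b :* (x :* a) :+ x :* s := x :* (b :* a :+ s)) refl β (bit b) (w 0) _)

  fsum-eval : ∀ {n} β (v : Vec Bool n) → fsum (pow β) v ≡ eval K β (toList v)
  fsum-eval β [] = refl
  fsum-eval β (b ∷ v) = cong₂ _+F_ (*-identityʳ _) (trans (fsum-scale β (pow β) v) (cong (β *F_) (fsum-eval β v)))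

  -- Multiplication by `β` would give the last entry the weight `β^n`; the shift gives it the weight
  -- 1, which is the same.
  fsum-shift : ∀ n β → pow β n ≡ 1F → (v : Vec Bool n) → fsum (pow β) (shift v) ≡ β *F fsum (pow β) v
  fsum-shift zero β _ [] = sym (zeroʳ β)
  fsum-shift (suc n) β βⁿ≡1 v with initLast v
  ... | u , b , refl = begin
    bit b *F 1F +F fsum (λ i → β *F pow β i) u
      ≡⟨ cong₂ (λ s t → bit b *F s +F t) (sym βⁿ≡1) (fsum-scale β (pow β) u) ⟩
    bit b *F (β *F pow β n) +F β *F fsum (pow β) u
      ≡⟨ solve 4 (λ x b p s → b :* (x :* p) :+ x :* s := x :* (s :+ b :* p)) refl β (bit b) (pow β n) _ ⟩
    β *F (fsum (pow β) u +F bit b *F pow β n)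
      ≡⟨ cong (β *F_) (sym (fsum-∷ʳ (pow β) u b)) ⟩
    β *F fsum (pow β) (u ∷ʳ b) ∎
    where open ≡-Reasoning

  -- Reduction subtracts multiples of x^n - 1, which vanishes at `β`; each Horner step of `eval`
  -- matches one cyclic shift.
  fsum-reduce : ∀ n .{{_ : NonZero n}} β → pow β n ≡ 1F → ∀ p → fsum (pow β) (reduce n p) ≡ eval K β p
  fsum-reduce n β _ [] = fsum-false n (pow β)
  fsum-reduce (suc n) β βⁿ≡1 (b ∷ p) = begin
    fsum (pow β) (zipWith _xor_ (b ∷ replicate n false) (shift (reduce (suc n) p)))
      ≡⟨ fsum-xor (pow β) (b ∷ replicate n false) (shift (reduce (suc n) p)) ⟩
    bit b *F 1F +F fsum _ (replicate n false) +F fsum (pow β) (shift (reduce (suc n) p))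
      ≡⟨ cong₂ _+F_ (cong₂ _+F_ (*-identityʳ _) (fsum-false n _))
           (trans (fsum-shift (suc n) β βⁿ≡1 (reduce (suc n) p)) (cong (β *F_) (fsum-reduce (suc n) β βⁿ≡1 p))) ⟩
    bit b +F 0F +F β *F eval K β p
      ≡⟨ cong (_+F β *F eval K β p) (+-identityʳ _) ⟩
    bit b +F β *F eval K β p ∎
    where open ≡-Reasoning

  codeword⇒roots : ∀ n .{{_ : NonZero n}} β p g → pow β n ≡ 1F → eval K β p ≡ 0F → p ∣P g →
    ∀ c → CyclicCode n g c → fsum (pow β) c ≡ 0F
  codeword⇒roots n β p g βⁿ≡1 pβ≡0 p∣g c (h , refl) = begin
    fsum (pow β) (reduce n (pmul g h))  ≡⟨ fsum-reduce n β βⁿ≡1 (pmul g h) ⟩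
    eval K β (pmul g h)                 ≡⟨ eval-pmul β g h ⟩
    eval K β g *F eval K β h            ≡⟨ cong (_*F eval K β h) (root-∣ β p g pβ≡0 p∣g) ⟩
    0F *F eval K β h                    ≡⟨ zeroˡ _ ⟩
    0F ∎
    where open ≡-Reasoning

  -- The polynomial of the word itself is a common multiple of `p₁` and `p₂`, hence a multiple of
  -- `g`.
  roots⇒codeword : ∀ n β₁ β₂ p₁ p₂ g → IsMinPoly K β₁ p₁ → IsMinPoly K β₂ p₂ → IsLcm p₁ p₂ g →
    (c : Vec Bool n) → fsum (pow β₁) c ≡ 0F → fsum (pow β₂) c ≡ 0F → CyclicCode n g c
  roots⇒codeword n β₁ β₂ p₁ p₂ g min₁ min₂ (_ , _ , _ , least) c z₁ z₂
    with least (toList c) (minPoly-∣ β₁ p₁ min₁ (toList c) (trans (sym (fsum-eval β₁ c)) z₁))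
                          (minPoly-∣ β₂ p₂ min₂ (toList c) (trans (sym (fsum-eval β₂ c)) z₂))
  ... | h , gh≈c = h , (begin
    reduce n (pmul g h)          ≡⟨ sym (reduce-trim n (pmul g h)) ⟩
    reduce n (trim (pmul g h))   ≡⟨ cong (reduce n) gh≈c ⟩
    reduce n (trim (toList c))   ≡⟨ reduce-trim n (toList c) ⟩
    reduce n (toList c)          ≡⟨ reduce-toList c ⟩
    c ∎)
    where open ≡-Reasoning

-- Sextuples of field elements

module _ {m : ℕ} (K : GF2^ m) where
  open Field K

  module Sextuples
    (elems : List F) (elems-unique : Unique elems) (elems-complete : ∀ x → x ∈ elems)
    (φ φ⁻¹ : F → F)
    (φ-+ : ∀ x y → φ (x +F y) ≡ φ x +F φ y)
    (φ-* : ∀ x y → φ (x *F y) ≡ φ x *F φ y)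
    (φ⁻¹-φ : ∀ x → φ⁻¹ (φ x) ≡ x) (φ-φ⁻¹ : ∀ x → φ (φ⁻¹ x) ≡ x)
    where

    open Enumerated _≟F_ elems elems-unique elems-complete public

    δ-by-sum : ∀ {x y u v} → x +F y ≡ u +F v → δ x y ≡ δ u v
    δ-by-sum eq = δ-cong (by-sum (sym eq)) (by-sum eq)

    Z : ℕ
    Z = length elems

    Q : F → F
    Q x = φ x *F x

    -- The polar form of `Q`: `Q (x + y) = Q x + Q y + B x y`. It is additive in both arguments, and
    -- `B x x = 0`.
    B : F → F → F
    B x y = φ x *F y +F x *F φ y

    Σ₁ ΣQ : List F → F
    Σ₁ = foldr (λ x s → x +F s) 0F
    ΣQ = foldr (λ x s → Q x +F s) 0F

    -- The parity condition is left to the length of the list.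
    code : List F → ℕ
    code ps = δ (Σ₁ ps) 0F * δ (ΣQ ps) 0F

    -- The new points are chosen in order, so a word through `ps` is counted `k !` times.
    extensions : ℕ → List F → ℕ
    extensions zero ps = code ps
    extensions (suc k) ps = ∑∉ ps (λ x → extensions k (x ∷ ps))

    -- Opaque, because rewriting normalises the proof.
    abstract
      φ-0 : φ 0F ≡ 0F
      φ-0 = trans (cong φ (sym (x+x≡0 0F))) (trans (φ-+ 0F 0F) (x+x≡0 _))

      φ-1 : φ 1F ≡ 1F
      φ-1 = *-cancelˡ φ1≢0 (trans (sym (φ-* 1F 1F)) (trans (cong φ (*-identityˡ 1F)) (sym (*-identityʳ _))))
        where
        φ1≢0 : φ 1F ≢ 0F
        φ1≢0 eq = 0≢1 (sym (trans (sym (φ⁻¹-φ 1F)) (trans (cong φ⁻¹ (trans eq (sym φ-0))) (φ⁻¹-φ 0F))))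

    φ-nonzero : ∀ {x} → x ≢ 0F → φ x ≢ 0F
    φ-nonzero {x} nz eq = nz (trans (sym (φ⁻¹-φ x)) (trans (cong φ⁻¹ (trans eq (sym φ-0))) (φ⁻¹-φ 0F)))

    -- Affine invariance.

    module Affine (x₀ d : F) (d≢0 : d ≢ 0F) where
      T : F → F
      T x = x₀ +F d *F x

      T⁻¹ : F → F
      T⁻¹ y = d ⁻¹⟨ d≢0 ⟩ *F (x₀ +F y)

      T⁻¹-T : ∀ x → T⁻¹ (T x) ≡ x
      T⁻¹-T x = trans (cong (d ⁻¹⟨ d≢0 ⟩ *F_) (solve 2 (λ a b → a :+ (a :+ b) := b) refl x₀ (d *F x)))
        (inverse-cancelˡ d≢0 x)

      T-T⁻¹ : ∀ y → T (T⁻¹ y) ≡ y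
      T-T⁻¹ y = trans (cong (x₀ +F_) (inverse-cancelʳ d≢0 (x₀ +F y))) (solve 2 (λ a b → a :+ (a :+ b) := b) refl x₀ y)

      notIn-T : ∀ x ps → notIn (T x) (map T ps) ≡ notIn x ps
      notIn-T x [] = refl
      notIn-T x (p ∷ ps) = cong₂ _*_
        (ε-cong (λ eq → trans (sym (T⁻¹-T x)) (trans (cong T⁻¹ eq) (T⁻¹-T p))) (cong T)) (notIn-T x ps)

      -- The length modulo 2, as a field element.
      length-F : List F → F
      length-F = foldr (λ _ s → 1F +F s) 0F

      Σ₁-T : ∀ ps → Σ₁ (map T ps) ≡ length-F ps *F x₀ +F d *F Σ₁ ps
      Σ₁-T [] = solve 2 (λ x d → :0 := :0 :* x :+ d :* :0) refl x₀ d
      Σ₁-T (p ∷ ps) = trans (cong (T p +F_) (Σ₁-T ps))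
        (solve 5 (λ x d p n s → x :+ d :* p :+ (n :* x :+ d :* s) := (:1 :+ n) :* x :+ d :* (p :+ s)) refl
          x₀ d p (length-F ps) (Σ₁ ps))

      ΣQ-T : ∀ ps → ΣQ (map T ps) ≡
        length-F ps *F Q x₀ +F (φ x₀ *F d *F Σ₁ ps +F x₀ *F φ d *F φ (Σ₁ ps)) +F Q d *F ΣQ ps
      ΣQ-T [] rewrite φ-0 = solve 4 (λ x x' d d' →
        :0 := :0 :* (x' :* x) :+ (x' :* d :* :0 :+ x :* d' :* :0) :+ d' :* d :* :0) refl x₀ (φ x₀) d (φ d)
      ΣQ-T (p ∷ ps) rewrite ΣQ-T ps | φ-+ x₀ (d *F p) | φ-* d p | φ-+ p (Σ₁ ps) =
        solve 10 (λ x x' d d' p p' n s s' t →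
          (x' :+ d' :* p') :* (x :+ d :* p) :+ (n :* (x' :* x) :+ (x' :* d :* s :+ x :* d' :* s') :+ d' :* d :* t)
          := (:1 :+ n) :* (x' :* x) :+ (x' :* d :* (p :+ s) :+ x :* d' :* (p' :+ s')) :+ d' :* d :* (p' :* p :+ t)) refl
          x₀ (φ x₀) d (φ d) p (φ p) (length-F ps) (Σ₁ ps) (φ (Σ₁ ps)) (ΣQ ps)

      -- Even length removes the terms in `x₀` and `Q x₀`. If the linear sum vanishes, so do the
      -- mixed terms, and the quadratic sum is merely scaled by `Q d ≠ 0`. If it does not vanish,
      -- neither does its multiple by `d`, and both indicators are 0.
      code-T : ∀ ps → length-F ps ≡ 0F → code (map T ps) ≡ code ps
      code-T ps even with Σ₁ ps ≟F 0F
      ... | no s≢0 rewrite Σ₁-T ps | even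
          | δ-≢ {0F *F x₀ +F d *F Σ₁ ps} {0F} (λ eq → *-nonzero d≢0 s≢0
              (trans (solve 2 (λ x s → s := :0 :* x :+ s) refl x₀ (d *F Σ₁ ps)) eq)) = refl
      ... | yes s≡0 = cong₂ _*_
          (δ-≡ (trans (Σ₁-T ps) (trans (cong₂ (λ n s → n *F x₀ +F d *F s) even s≡0)
            (solve 2 (λ x d → :0 :* x :+ d :* :0 := :0) refl x₀ d))))
          (δ-cong (λ eq → *-cancelˡ Qd≢0 (trans (sym ΣQ-T') (trans eq (sym (zeroʳ _)))))
                  (λ eq → trans ΣQ-T' (trans (cong (Q d *F_) eq) (zeroʳ _))))
        where
        Qd≢0 : Q d ≢ 0F
        Qd≢0 = *-nonzero (φ-nonzero d≢0) d≢0
        ΣQ-T' : ΣQ (map T ps) ≡ Q d *F ΣQ ps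
        ΣQ-T' = trans (ΣQ-T ps) (trans
          (cong₂ (λ n s → n *F Q x₀ +F (φ x₀ *F d *F s +F x₀ *F φ d *F φ s) +F Q d *F ΣQ ps) even s≡0)
          (trans (cong (λ z → 0F *F Q x₀ +F (φ x₀ *F d *F 0F +F x₀ *F φ d *F z) +F Q d *F ΣQ ps) φ-0)
          (solve 5 (λ x x' d d' t → :0 :* (x' :* x) :+ (x' :* d :* :0 :+ x :* d' :* :0) :+ t := t) refl
            x₀ (φ x₀) d (φ d) (Q d *F ΣQ ps))))

      -- Evenness matters only for the completed list, whose entries are not chosen yet; hence a
      -- hypothesis on all lists of that length.
      extensions-T : ∀ k ps → (∀ qs → length qs ≡ k + length ps → length-F qs ≡ 0F) →
        extensions k (map T ps) ≡ extensions k ps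
      extensions-T zero ps even = code-T ps (even ps refl)
      extensions-T (suc k) ps even = begin
        ∑ₑ (λ y → notIn y (map T ps) * extensions k (y ∷ map T ps))
          ≡⟨ sym (∑-bij T T⁻¹ T⁻¹-T T-T⁻¹ _) ⟩
        ∑ₑ (λ x → notIn (T x) (map T ps) * extensions k (map T (x ∷ ps)))
          ≡⟨ ∑-cong elems (λ x → cong₂ _*_ (notIn-T x ps) (extensions-T k (x ∷ ps)
               (λ qs eq → even qs (trans eq (ℕ.+-suc k (length ps)))))) ⟩
        ∑∉ ps (λ x → extensions k (x ∷ ps)) ∎
        where open ≡-Reasoning

    ∑-shift : ∀ a h → ∑ₑ (λ x → h (a +F x)) ≡ ∑ₑ h
    ∑-shift a = ∑-bij (a +F_) (a +F_) inv inv
      where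
      inv : ∀ x → a +F (a +F x) ≡ x
      inv = solve 2 (λ a b → a :+ (a :+ b) := b) refl a

    ∑-scale : ∀ {a} → a ≢ 0F → ∀ h → ∑ₑ (λ x → h (a *F x)) ≡ ∑ₑ h
    ∑-scale {a} nz = ∑-bij (a *F_) (a ⁻¹⟨ nz ⟩ *F_) (inverse-cancelˡ nz) (inverse-cancelʳ nz)

    -- Quadruples completing 0 and 1, repeated points allowed.

    module Count
      (fix-count : ∑ₑ (λ x → δ (φ x) x) ≡ 4)
      (fix²-count : ∑ₑ (λ x → δ (φ (φ x)) x) ≡ 16)
      where

      isFixed : F → ℕ
      isFixed x = δ (φ x) x

      B-bilinear : ∀ x y z → B x (y +F z) ≡ B x y +F B x z
      B-bilinear x y z = trans (cong (λ t → φ x *F (y +F z) +F x *F t) (φ-+ y z))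
        (solve 6 (λ x' x y y' z z' → x' :* (y :+ z) :+ x :* (y' :+ z') := x' :* y :+ x :* y' :+ (x' :* z :+ x :* z')) refl
          (φ x) x y (φ y) z (φ z))

      -- Since `B u (u x) = Q u · (φ x + x)`, the kernel of `B u` is `u · Fix φ`.
      kernel-count : ∀ {u} → u ≢ 0F → ∑ₑ (λ x → δ (B u x) 0F) ≡ 4
      kernel-count {u} nz = begin
        ∑ₑ (λ x → δ (B u x) 0F)
          ≡⟨ sym (∑-scale nz _) ⟩
        ∑ₑ (λ x → δ (B u (u *F x)) 0F)
          ≡⟨ ∑-cong elems (λ x → δ-cong (fwd x) (bwd x)) ⟩
        ∑ₑ (λ x → δ (φ x) x)
          ≡⟨ fix-count ⟩
        4 ∎
        where
        open ≡-Reasoning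
        B-u : ∀ x → B u (u *F x) ≡ φ u *F u *F (φ x +F x)
        B-u x = trans (cong (λ t → φ u *F (u *F x) +F u *F t) (φ-* u x))
          (solve 4 (λ u u' x x' → u' :* (u :* x) :+ u :* (u' :* x') := u' :* u :* (x' :+ x)) refl u (φ u) x (φ x))
        fwd : ∀ x → B u (u *F x) ≡ 0F → φ x ≡ x
        fwd x eq = by-sum (sym (+-identityʳ _)) (*-cancelˡ (*-nonzero (φ-nonzero nz) nz)
          (trans (sym (B-u x)) (trans eq (sym (zeroʳ _)))))
        bwd : ∀ x → φ x ≡ x → B u (u *F x) ≡ 0F
        bwd x eq = trans (B-u x) (trans (cong (φ u *F u *F_) (trans (cong (_+F x) eq) (x+x≡0 x))) (zeroʳ _))

      fibre-count : ∀ {u} v → u ≢ 0F → ∑ₑ (λ x → δ (B u x) (B u v)) ≡ 4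
      fibre-count {u} v nz = begin
        ∑ₑ (λ x → δ (B u x) (B u v))
          ≡⟨ sym (∑-shift v _) ⟩
        ∑ₑ (λ x → δ (B u (v +F x)) (B u v))
          ≡⟨ ∑-cong elems (λ x → trans (cong (λ t → δ t (B u v)) (B-bilinear u v x))
               (δ-by-sum (solve 2 (λ a b → a :+ b :+ a := b :+ :0) refl (B u v) (B u x)))) ⟩
        ∑ₑ (λ x → δ (B u x) 0F)
          ≡⟨ kernel-count nz ⟩
        4 ∎
        where open ≡-Reasoning

      -- For d = 1 + a + b + c the six points 0, 1, a, b, c, d satisfy the quadratic
      -- condition exactly when this indicator is 1.
      κ : F → F → F → ℕ
      κ a b c = δ (B (1F +F a +F b) c) (B (1F +F a) (1F +F b))

      -- Polarising `Q (1 + a + b + c)` leaves `B` summed over all pairs from 1, `a`, `b`, `c`. The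
      -- pairs with `c` give `B (1 + a + b) c`, the other three give `B (1 + a) (1 + b)`.
      ΣQ-κ : ∀ a b c → ΣQ ((1F +F a +F b +F c) ∷ c ∷ b ∷ a ∷ 1F ∷ 0F ∷ []) +F 0F ≡
        B (1F +F a +F b) c +F B (1F +F a) (1F +F b)
      ΣQ-κ a b c rewrite φ-+ (1F +F a +F b) c | φ-+ (1F +F a) b | φ-+ 1F a | φ-+ 1F b | φ-1 | φ-0 =
        solve 6 (λ a a' b b' c c' →
          (:1 :+ a' :+ b' :+ c') :* (:1 :+ a :+ b :+ c) :+ (c' :* c :+ (b' :* b :+ (a' :* a :+ (:1 :* :1 :+ (:0 :* :0 :+ :0))))) :+ :0
          := (:1 :+ a' :+ b') :* c :+ (:1 :+ a :+ b) :* c' :+ ((:1 :+ a') :* (:1 :+ b) :+ (:1 :+ a) :* (:1 :+ b')))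
          refl a (φ a) b (φ b) c (φ c)

      code-κ : ∀ a b c d → code (d ∷ c ∷ b ∷ a ∷ 1F ∷ 0F ∷ []) ≡ δ d (1F +F a +F b +F c) * κ a b c
      code-κ a b c d = case (d ≟F (1F +F a +F b +F c))
        where
        case : (dec : Dec (d ≡ 1F +F a +F b +F c)) → code (d ∷ c ∷ b ∷ a ∷ 1F ∷ 0F ∷ []) ≡ ⟦ dec ⟧ * κ a b c
        case (no d≢) = cong (_* δ (ΣQ (d ∷ c ∷ b ∷ a ∷ 1F ∷ 0F ∷ [])) 0F) (δ-≢ λ eq → d≢ (by-sum
          (solve 4 (λ a b c d → d :+ (:1 :+ a :+ b :+ c) := (d :+ (c :+ (b :+ (a :+ (:1 :+ (:0 :+ :0)))))) :+ :0)
            refl a b c d) eq))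
        case (yes refl) = cong₂ _*_
          (δ-≡ (solve 3 (λ a b c → (:1 :+ a :+ b :+ c) :+ (c :+ (b :+ (a :+ (:1 :+ (:0 :+ :0))))) := :0) refl a b c))
          (δ-by-sum (ΣQ-κ a b c))

      total-count : ∑ₑ (λ a → ∑ₑ (λ b → ∑ₑ (λ c → κ a b c))) ≡ Z * Z + 48 * Z
      total-count = begin
        ∑ₑ (λ a → ∑ₑ (λ b → ∑ₑ (λ c → κ a b c)))
          ≡⟨ ∑-cong elems (λ a → ∑-swap elems elems _) ⟩
        ∑ₑ (λ a → ∑ₑ (λ c → ∑ₑ (λ b → κ a b c)))
          ≡⟨ ∑-swap elems elems _ ⟩
        ∑ₑ (λ c → ∑ₑ (λ a → ∑ₑ (λ b → κ a b c)))
          ≡⟨ ∑-cong elems (λ c → ∑-cong elems (λ a → ∑-cong elems (λ b →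
               δ-by-sum (sym (change a b c))))) ⟩
        ∑ₑ (λ c → ∑ₑ (λ a → ∑ₑ (λ b → δ (φ c +F c) (B (c +F 1F +F a) (c +F 1F +F b)))))
          ≡⟨ ∑-cong elems (λ c → trans
               (∑-shift (c +F 1F) (λ s → ∑ₑ (λ b → δ (φ c +F c) (B s (c +F 1F +F b)))))
               (∑-cong elems (λ s → ∑-shift (c +F 1F) (λ t → δ (φ c +F c) (B s t))))) ⟩
        ∑ₑ (λ c → ∑ₑ (λ s → ∑ₑ (λ t → δ (φ c +F c) (B s t))))
          ≡⟨ ∑-swap elems elems _ ⟩
        ∑ₑ (λ s → ∑ₑ (λ c → ∑ₑ (λ t → δ (φ c +F c) (B s t))))
          ≡⟨ ∑-cong elems (λ s → trans (∑-swap elems elems _) (∑-cong elems (λ t → sym (∑-shift (φ s *F t) _)))) ⟩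
        ∑ₑ (λ s → ∑ₑ (λ t → ∑ₑ (λ c → δ (φ (φ s *F t +F c) +F (φ s *F t +F c)) (B s t))))
          ≡⟨ ∑-cong elems (λ s → ∑-cong elems (λ t → ∑-cong elems (λ c →
               δ-by-sum (sym (untwist s t c))))) ⟩
        ∑ₑ (λ s → ∑ₑ (λ t → ∑ₑ (λ c → δ ((φ (φ s) +F s) *F φ t) (φ c +F c))))
          ≡⟨ ∑-cong elems slice ⟩
        ∑ₑ (λ s → Z + 3 * Z * δ (φ (φ s)) s)
          ≡⟨ ∑-+ elems _ _ ⟩
        ∑ₑ (λ _ → Z) + ∑ₑ (λ s → 3 * Z * δ (φ (φ s)) s)
          ≡⟨ cong₂ _+_ (∑-const elems Z) (trans (∑-*ˡ elems (3 * Z) _) (cong (3 * Z *_) fix²-count)) ⟩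
        Z * Z + 3 * Z * 16
          ≡⟨ cong (Z * Z +_) (NS.solve 1 (λ z → NS.con 3 NS.:* z NS.:* NS.con 16 NS.:= NS.con 48 NS.:* z) refl Z) ⟩
        Z * Z + 48 * Z ∎
        where
        open ≡-Reasoning
        change : ∀ a b c → (φ c +F c) +F B (c +F 1F +F a) (c +F 1F +F b) ≡ B (1F +F a +F b) c +F B (1F +F a) (1F +F b)
        change a b c rewrite φ-+ (c +F 1F) a | φ-+ (c +F 1F) b | φ-+ c 1F | φ-+ (1F +F a) b | φ-+ 1F a | φ-+ 1F b | φ-1 =
          solve 6 (λ a a' b b' c c' →
            (c' :+ c) :+ ((c' :+ :1 :+ a') :* (c :+ :1 :+ b) :+ (c :+ :1 :+ a) :* (c' :+ :1 :+ b'))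
            := (:1 :+ a' :+ b') :* c :+ (:1 :+ a :+ b) :* c' :+ ((:1 :+ a') :* (:1 :+ b) :+ (:1 :+ a) :* (:1 :+ b')))
            refl a (φ a) b (φ b) c (φ c)
        untwist : ∀ s t c → (φ (φ s) +F s) *F φ t +F (φ c +F c) ≡ (φ (φ s *F t +F c) +F (φ s *F t +F c)) +F B s t
        untwist s t c rewrite φ-+ (φ s *F t) c | φ-* (φ s) t =
          solve 7 (λ s s' s'' t t' c c' →
            (s'' :+ s) :* t' :+ (c' :+ c) := (s'' :* t' :+ c' :+ (s' :* t :+ c)) :+ (s' :* t :+ s :* t'))
            refl s (φ s) (φ (φ s)) t (φ t) c (φ c)
        slice : ∀ s → ∑ₑ (λ t → ∑ₑ (λ c → δ ((φ (φ s) +F s) *F φ t) (φ c +F c))) ≡ Z + 3 * Z * δ (φ (φ s)) s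
        slice s with φ (φ s) ≟F s
        ... | yes eq = begin
          ∑ₑ (λ t → ∑ₑ (λ c → δ ((φ (φ s) +F s) *F φ t) (φ c +F c)))
            ≡⟨ ∑-cong elems (λ t → ∑-cong elems (λ c → trans
                 (cong (λ z → δ z (φ c +F c)) (trans (cong (λ z → (z +F s) *F φ t) eq)
                   (solve 2 (λ s t → (s :+ s) :* t := :0) refl s (φ t))))
                 (δ-by-sum (+-identityˡ (φ c +F c))))) ⟩
          ∑ₑ (λ t → ∑ₑ (λ c → δ (φ c) c))
            ≡⟨ trans (∑-const elems _) (cong (Z *_) fix-count) ⟩
          Z * 4
            ≡⟨ NS.solve 1 (λ z → z NS.:* NS.con 4 NS.:= z NS.:+ NS.con 3 NS.:* z NS.:* NS.con 1) refl Z ⟩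
          Z + 3 * Z * 1 ∎
        ... | no neq = begin
          ∑ₑ (λ t → ∑ₑ (λ c → δ (k *F φ t) (φ c +F c)))
            ≡⟨ ∑-swap elems elems _ ⟩
          ∑ₑ (λ c → ∑ₑ (λ t → δ (k *F φ t) (φ c +F c)))
            ≡⟨ ∑-cong elems (λ c → trans
                 (∑-bij φ φ⁻¹ φ⁻¹-φ φ-φ⁻¹ (λ t → δ (k *F t) (φ c +F c)))
                 (trans (∑-scale k≢0 (λ t → δ t (φ c +F c))) (∑-δ₁ (φ c +F c)))) ⟩
          ∑ₑ (λ _ → 1)
            ≡⟨ ∑-const elems 1 ⟩
          Z * 1
            ≡⟨ NS.solve 1 (λ z → z NS.:* NS.con 1 NS.:= z NS.:+ NS.con 3 NS.:* z NS.:* NS.con 0) refl Z ⟩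
          Z + 3 * Z * 0 ∎
          where
          k : F
          k = φ (φ s) +F s
          k≢0 : k ≢ 0F
          k≢0 eq = neq (by-sum (sym (+-identityʳ _)) eq)

      -- Pairs (a, b) in special position.

      G : F → F → ℕ
      G a b = ∑ₑ (κ a b)

      private
        -- Each `b ≠ 0` admits 4 values of `c`, and `b = 0` admits all `Z`: in total
        -- `4 (Z − 1) + Z`.
        ∑-∑B : ∀ v → ∑ₑ (λ b → ∑ₑ (λ c → δ (B b c) (B b v))) + 4 ≡ 5 * Z
        ∑-∑B v = begin
          ∑ₑ (λ b → ∑ₑ (λ c → δ (B b c) (B b v))) + 4
            ≡⟨ cong (_+ 4) (∑-delete {0F ∷ []} ([] ∷ []) _) ⟩
          ∑∉ (0F ∷ []) (λ b → ∑ₑ (λ c → δ (B b c) (B b v))) + (∑ₑ (λ c → δ (B 0F c) (B 0F v)) + 0) + 4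
            ≡⟨ cong₂ (λ x y → x + (y + 0) + 4) (∑∉-cong (0F ∷ []) λ { b (b≢0 ∷ []) → fibre-count v b≢0 })
                 (trans (∑-cong elems (λ c → δ-≡ (trans (B-0 c) (sym (B-0 v))))) (∑-const elems 1)) ⟩
          ∑∉ (0F ∷ []) (λ _ → 4) + (Z * 1 + 0) + 4
            ≡⟨ NS.solve 2 (λ x z → x NS.:+ (z NS.:* NS.con 1 NS.:+ NS.con 0) NS.:+ NS.con 4 NS.:= x NS.:+ (NS.con 4 NS.:+ NS.con 0) NS.:+ z)
                 refl (∑∉ (0F ∷ []) (λ _ → 4)) Z ⟩
          ∑∉ (0F ∷ []) (λ _ → 4) + (4 + 0) + Z
            ≡⟨ cong (_+ Z) (sym (∑-delete {0F ∷ []} ([] ∷ []) (λ _ → 4))) ⟩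
          ∑ₑ (λ _ → 4) + Z
            ≡⟨ cong (_+ Z) (∑-const elems 4) ⟩
          Z * 4 + Z
            ≡⟨ NS.solve 1 (λ z → z NS.:* NS.con 4 NS.:+ z NS.:= NS.con 5 NS.:* z) refl Z ⟩
          5 * Z ∎
          where
          open ≡-Reasoning
          B-0 : ∀ c → B 0F c ≡ 0F
          B-0 c rewrite φ-0 = solve 2 (λ c c' → :0 :* c :+ :0 :* c' := :0) refl c (φ c)

      -- For `a = 0` the right side of `κ` is `B 1 (1 + b) = B (1 + b) 1`, so the admissible `c`
      -- form a fibre of `B (1 + b)`. With `a` equal to 0 or 1 every solution repeats a point.
      G-0 : ∑ₑ (λ b → G 0F b) + 4 ≡ 5 * Z
      G-0 = trans (cong (_+ 4) (trans
        (∑-cong elems λ b → ∑-cong elems λ c → cong₂ δ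
          (cong (λ t → B t c) (solve 1 (λ b → :1 :+ :0 :+ b := :1 :+ b) refl b)) (swap b))
        (∑-shift 1F (λ b → ∑ₑ (λ c → δ (B b c) (B b 1F)))))) (∑-∑B 1F)
        where
        swap : ∀ b → B (1F +F 0F) (1F +F b) ≡ B (1F +F b) 1F
        swap b rewrite φ-+ 1F 0F | φ-+ 1F b | φ-1 | φ-0 = solve 2 (λ b b' →
          (:1 :+ :0) :* (:1 :+ b) :+ (:1 :+ :0) :* (:1 :+ b') := (:1 :+ b') :* :1 :+ (:1 :+ b) :* :1) refl b (φ b)

      G-1 : ∑ₑ (λ b → G 1F b) + 4 ≡ 5 * Z
      G-1 = trans (cong (_+ 4) (∑-cong elems λ b → ∑-cong elems λ c → cong₂ δ
          (cong (λ t → B t c) (solve 1 (λ b → :1 :+ :1 :+ b := b) refl b)) (zeros b))) (∑-∑B 0F)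
        where
        zeros : ∀ b → B (1F +F 1F) (1F +F b) ≡ B b 0F
        zeros b rewrite φ-+ 1F 1F | φ-+ 1F b | φ-1 | φ-0 = solve 2 (λ b b' →
          (:1 :+ :1) :* (:1 :+ b) :+ (:1 :+ :1) :* (:1 :+ b') := b' :* :0 :+ b :* :0) refl b (φ b)

      G-a-0 : ∀ {a} → a ≢ 1F → G a 0F ≡ 4
      G-a-0 {a} a≢1 = trans (∑-cong elems λ c → cong₂ δ
          (cong (λ t → B t c) (+-identityʳ (1F +F a))) (cong (B (1F +F a)) (+-identityʳ 1F)))
        (fibre-count 1F λ eq → a≢1 (by-sum (solve 1 (λ a → a :+ :1 := :1 :+ a :+ :0) refl a) eq))

      G-a-1 : ∀ {a} → a ≢ 0F → G a 1F ≡ 4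
      G-a-1 {a} a≢0 = trans (∑-cong elems λ c → cong₂ δ
          (cong (λ t → B t c) (solve 1 (λ a → :1 :+ a :+ :1 := a) refl a)) zeros) (fibre-count 0F a≢0)
        where
        zeros : B (1F +F a) (1F +F 1F) ≡ B a 0F
        zeros rewrite φ-+ 1F 1F | φ-+ 1F a | φ-1 | φ-0 = solve 2 (λ a a' →
          (:1 :+ a') :* (:1 :+ :1) :+ (:1 :+ a) :* (:1 :+ :1) := a' :* :0 :+ a :* :0) refl a (φ a)

      G-a-a : ∀ a → G a a ≡ 4
      G-a-a a = trans (∑-cong elems λ c → cong₂ δ
          (cong (λ t → B t c) (solve 1 (λ a → :1 :+ a :+ a := :1) refl a)) zeros) (fibre-count 0F (λ eq → 0≢1 (sym eq)))
        where
        zeros : B (1F +F a) (1F +F a) ≡ B 1F 0F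
        zeros rewrite φ-+ 1F a | φ-1 | φ-0 = solve 2 (λ a a' →
          (:1 :+ a') :* (:1 :+ a) :+ (:1 :+ a) :* (:1 :+ a') := :1 :* :0 :+ :1 :* :0) refl a (φ a)

      -- Here `1 + a + b = 0`, so `c` drops out. What remains is `B (1 + a) a = 0`, that is
      -- `φ a = a`, and then every `c` is admissible.
      G-a-1+a : ∀ a → G a (1F +F a) ≡ Z * isFixed a
      G-a-1+a a = trans (∑-cong elems λ c → δ-by-sum (key c)) (∑-const elems (isFixed a))
        where
        key : ∀ c → B (1F +F a +F (1F +F a)) c +F B (1F +F a) (1F +F (1F +F a)) ≡ φ a +F a
        key c rewrite φ-+ (1F +F a) (1F +F a) | φ-+ 1F (1F +F a) | φ-+ 1F a | φ-1 = solve 4 (λ a a' c c' →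
          (:1 :+ a' :+ (:1 :+ a')) :* c :+ (:1 :+ a :+ (:1 :+ a)) :* c' :+
            ((:1 :+ a') :* (:1 :+ (:1 :+ a)) :+ (:1 :+ a) :* (:1 :+ (:1 :+ a'))) := a' :+ a)
          refl a (φ a) c (φ c)

      -- Removing the quadruples with repeated points.

      inner : F → F → ℕ
      inner a b = extensions 2 (b ∷ a ∷ 1F ∷ 0F ∷ [])

      inner-κ : ∀ a b → inner a b ≡ ∑∉ (b ∷ a ∷ 1F ∷ 0F ∷ []) λ c →
        notIn (1F +F a +F b +F c) (c ∷ b ∷ a ∷ 1F ∷ 0F ∷ []) * κ a b c
      inner-κ a b = ∑-cong elems λ c → cong (notIn c (b ∷ a ∷ 1F ∷ 0F ∷ []) *_) (trans
        (∑-cong elems λ d → trans (cong (notIn d (c ∷ b ∷ a ∷ 1F ∷ 0F ∷ []) *_) (code-κ a b c d))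
          (exchange (notIn d (c ∷ b ∷ a ∷ 1F ∷ 0F ∷ [])) (δ d (1F +F a +F b +F c)) (κ a b c)))
        (∑-δ (1F +F a +F b +F c) (λ d → notIn d (c ∷ b ∷ a ∷ 1F ∷ 0F ∷ []) * κ a b c)))
        where
        exchange : ∀ x y z → x * (y * z) ≡ y * (x * z)
        exchange = NS.solve 3 (λ x y z → x NS.:* (y NS.:* z) NS.:= y NS.:* (x NS.:* z)) refl

      -- The linear condition would force `d = c`.
      inner-1+a : ∀ a → inner a (1F +F a) ≡ 0
      inner-1+a a = trans (inner-κ a (1F +F a)) (trans (∑-cong elems vanish) (∑-zero elems))
        where
        L : List F
        L = (1F +F a) ∷ a ∷ 1F ∷ 0F ∷ []
        vanish : ∀ c → notIn c L * (notIn (1F +F a +F (1F +F a) +F c) (c ∷ L) * κ a (1F +F a) c) ≡ 0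
        vanish c = trans
          (cong (λ t → notIn c L * (t * notIn (1F +F a +F (1F +F a) +F c) L * κ a (1F +F a) c))
            (ε-≡ (solve 2 (λ a c → :1 :+ a :+ (:1 :+ a) :+ c := c) refl a c)))
          (ℕ.*-zeroʳ (notIn c L))

      -- `w + c` is the last point `d`, and the word condition is symmetric in `c` and `d`;
      -- algebraically, `B w w = 0`.
      κ-w+ : ∀ a b c → κ a b ((1F +F a +F b) +F c) ≡ κ a b c
      κ-w+ a b c = cong (λ t → δ t (B (1F +F a) (1F +F b))) (trans (B-bilinear w w c)
        (solve 3 (λ w w' t → w' :* w :+ w :* w' :+ t := t) refl w (φ w) (B w c)))
        where
        w : F
        w = 1F +F a +F b

      -- For `c = b` the two copies of `b` cancel and `0, 1, a, 1 + a` remain. In the same way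
      -- `κ-a`, `κ-1` and `κ-0` test the quadruples `0, 1, b, 1 + b`, then `0, a, b, a + b`, then
      -- `1, a, b, 1 + a + b`.
      κ-b : ∀ a b → κ a b b ≡ isFixed a
      κ-b a b = δ-by-sum key
        where
        key : B (1F +F a +F b) b +F B (1F +F a) (1F +F b) ≡ φ a +F a
        key rewrite φ-+ (1F +F a) b | φ-+ 1F a | φ-+ 1F b | φ-1 = solve 4 (λ a a' b b' →
          (:1 :+ a' :+ b') :* b :+ (:1 :+ a :+ b) :* b' :+ ((:1 :+ a') :* (:1 :+ b) :+ (:1 :+ a) :* (:1 :+ b')) := a' :+ a)
          refl a (φ a) b (φ b)

      κ-a : ∀ a b → κ a b a ≡ isFixed b
      κ-a a b = δ-by-sum key
        where
        key : B (1F +F a +F b) a +F B (1F +F a) (1F +F b) ≡ φ b +F b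
        key rewrite φ-+ (1F +F a) b | φ-+ 1F a | φ-+ 1F b | φ-1 = solve 4 (λ a a' b b' →
          (:1 :+ a' :+ b') :* a :+ (:1 :+ a :+ b) :* a' :+ ((:1 :+ a') :* (:1 :+ b) :+ (:1 :+ a) :* (:1 :+ b')) := b' :+ b)
          refl a (φ a) b (φ b)

      κ-1 : ∀ a b → κ a b 1F ≡ δ (B a b) 0F
      κ-1 a b = δ-by-sum key
        where
        key : B (1F +F a +F b) 1F +F B (1F +F a) (1F +F b) ≡ B a b +F 0F
        key rewrite φ-+ (1F +F a) b | φ-+ 1F a | φ-+ 1F b | φ-1 = solve 4 (λ a a' b b' →
          (:1 :+ a' :+ b') :* :1 :+ (:1 :+ a :+ b) :* :1 :+ ((:1 :+ a') :* (:1 :+ b) :+ (:1 :+ a) :* (:1 :+ b'))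
          := a' :* b :+ a :* b' :+ :0)
          refl a (φ a) b (φ b)

      κ-0 : ∀ a b → κ a b 0F ≡ δ (B (1F +F a) (1F +F b)) 0F
      κ-0 a b = δ-by-sum key
        where
        key : B (1F +F a +F b) 0F +F B (1F +F a) (1F +F b) ≡ B (1F +F a) (1F +F b) +F 0F
        key rewrite φ-0 = solve 3 (λ w w' t → w' :* :0 :+ w :* :0 :+ t := t :+ :0)
          refl (1F +F a +F b) (φ (1F +F a +F b)) (B (1F +F a) (1F +F b))

      -- The summands tell which three of the points 0, 1, a, b lie in a word of weight 4.
      quads : F → F → ℕ
      quads a b = isFixed a + (isFixed b + (δ (B a b) 0F + δ (B (1F +F a) (1F +F b)) 0F))

      notIn-++ : ∀ x ps qs → notIn x (ps ++ qs) ≡ notIn x ps * notIn x qs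
      notIn-++ x [] qs = sym (ℕ.*-identityˡ _)
      notIn-++ x (p ∷ ps) qs = trans (cong (ε x p *_) (notIn-++ x ps qs)) (sym (ℕ.*-assoc (ε x p) _ _))

      notIn-shift : ∀ w x ps → notIn (w +F x) ps ≡ notIn x (map (w +F_) ps)
      notIn-shift w x [] = refl
      notIn-shift w x (p ∷ ps) = cong₂ _*_
        (ε-cong (by-sum (move x p)) (by-sum (sym (move x p)))) (notIn-shift w x ps)
        where
        move : ∀ x p → x +F (w +F p) ≡ w +F x +F p
        move x p = solve 3 (λ w x p → x :+ (w :+ p) := w :+ x :+ p) refl w x p

      -- A solution repeats a point when `c` or `d = w + c` lies in `L`, that is, when `c` is one of
      -- the eight elements of `L` and `w + L`. Adding `w` preserves `κ`, so the two halves
      -- contribute `quads a b` each.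
      inner-good : ∀ {a b} → a ≢ 1F → a ≢ 0F → b ≢ 1F +F a → b ≢ a → b ≢ 1F → b ≢ 0F →
        G a b ≡ inner a b + 2 * quads a b
      inner-good {a} {b} a≢1 a≢0 b≢1+a b≢a b≢1 b≢0 = begin
        G a b
          ≡⟨ ∑-delete unique₈ (κ a b) ⟩
        ∑∉ (map (w +F_) L ++ L) (κ a b) + ∑ (map (w +F_) L ++ L) (κ a b)
          ≡⟨ cong₂ _+_ (trans (∑-cong elems regroup) (sym (inner-κ a b))) values ⟩
        inner a b + 2 * quads a b ∎
        where
        open ≡-Reasoning
        w : F
        w = 1F +F a +F b
        L : List F
        L = b ∷ a ∷ 1F ∷ 0F ∷ []
        w≢0 : w ≢ 0F
        w≢0 eq = b≢1+a (by-sum (solve 2 (λ a b → b :+ (:1 :+ a) := :1 :+ a :+ b :+ :0) refl a b) eq)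
        1≢0 : 1F ≢ 0F
        1≢0 eq = 0≢1 (sym eq)
        absurd : ∀ {x y u v} → x ≢ y → x +F y ≡ u +F v → u ≢ v
        absurd x≢y eq u≡v = x≢y (by-sum eq u≡v)
        -- As `w = 1 + a + b`, any two of the eight elements have the same sum as one of the pairs
        -- already known to be distinct.
        unique₈ : Unique (map (w +F_) L ++ L)
        unique₈ =
          ( absurd b≢a (solve 2 (λ a b → b :+ a := (:1 :+ a :+ b) :+ b :+ ((:1 :+ a :+ b) :+ a)) refl a b)
          ∷ absurd b≢1 (solve 2 (λ a b → b :+ :1 := (:1 :+ a :+ b) :+ b :+ ((:1 :+ a :+ b) :+ :1)) refl a b)
          ∷ absurd b≢0 (solve 2 (λ a b → b :+ :0 := (:1 :+ a :+ b) :+ b :+ ((:1 :+ a :+ b) :+ :0)) refl a b)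
          ∷ absurd w≢0 (solve 2 (λ a b → (:1 :+ a :+ b) :+ :0 := (:1 :+ a :+ b) :+ b :+ b) refl a b)
          ∷ absurd 1≢0 (solve 2 (λ a b → :1 :+ :0 := (:1 :+ a :+ b) :+ b :+ a) refl a b)
          ∷ absurd a≢0 (solve 2 (λ a b → a :+ :0 := (:1 :+ a :+ b) :+ b :+ :1) refl a b)
          ∷ absurd a≢1 (solve 2 (λ a b → a :+ :1 := (:1 :+ a :+ b) :+ b :+ :0) refl a b) ∷ [])
          ∷ ( absurd a≢1 (solve 2 (λ a b → a :+ :1 := (:1 :+ a :+ b) :+ a :+ ((:1 :+ a :+ b) :+ :1)) refl a b)
          ∷ absurd a≢0 (solve 2 (λ a b → a :+ :0 := (:1 :+ a :+ b) :+ a :+ ((:1 :+ a :+ b) :+ :0)) refl a b)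
          ∷ absurd 1≢0 (solve 2 (λ a b → :1 :+ :0 := (:1 :+ a :+ b) :+ a :+ b) refl a b)
          ∷ absurd w≢0 (solve 2 (λ a b → (:1 :+ a :+ b) :+ :0 := (:1 :+ a :+ b) :+ a :+ a) refl a b)
          ∷ absurd b≢0 (solve 2 (λ a b → b :+ :0 := (:1 :+ a :+ b) :+ a :+ :1) refl a b)
          ∷ absurd b≢1 (solve 2 (λ a b → b :+ :1 := (:1 :+ a :+ b) :+ a :+ :0) refl a b) ∷ [])
          ∷ ( absurd 1≢0 (solve 2 (λ a b → :1 :+ :0 := (:1 :+ a :+ b) :+ :1 :+ ((:1 :+ a :+ b) :+ :0)) refl a b)
          ∷ absurd a≢0 (solve 2 (λ a b → a :+ :0 := (:1 :+ a :+ b) :+ :1 :+ b) refl a b)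
          ∷ absurd b≢0 (solve 2 (λ a b → b :+ :0 := (:1 :+ a :+ b) :+ :1 :+ a) refl a b)
          ∷ absurd w≢0 (solve 2 (λ a b → (:1 :+ a :+ b) :+ :0 := (:1 :+ a :+ b) :+ :1 :+ :1) refl a b)
          ∷ absurd b≢a (solve 2 (λ a b → b :+ a := (:1 :+ a :+ b) :+ :1 :+ :0) refl a b) ∷ [])
          ∷ ( absurd a≢1 (solve 2 (λ a b → a :+ :1 := (:1 :+ a :+ b) :+ :0 :+ b) refl a b)
          ∷ absurd b≢1 (solve 2 (λ a b → b :+ :1 := (:1 :+ a :+ b) :+ :0 :+ a) refl a b)
          ∷ absurd b≢a (solve 2 (λ a b → b :+ a := (:1 :+ a :+ b) :+ :0 :+ :1) refl a b)
          ∷ absurd w≢0 (solve 2 (λ a b → (:1 :+ a :+ b) :+ :0 := (:1 :+ a :+ b) :+ :0 :+ :0) refl a b) ∷ [])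
          ∷ (b≢a ∷ b≢1 ∷ b≢0 ∷ []) ∷ (a≢1 ∷ a≢0 ∷ []) ∷ (1≢0 ∷ []) ∷ [] ∷ []
        regroup : ∀ c → notIn c (map (w +F_) L ++ L) * κ a b c ≡
          notIn c L * (notIn (w +F c) (c ∷ L) * κ a b c)
        regroup c = begin
          notIn c (map (w +F_) L ++ L) * κ a b c
            ≡⟨ cong (_* κ a b c) (notIn-++ c (map (w +F_) L) L) ⟩
          notIn c (map (w +F_) L) * notIn c L * κ a b c
            ≡⟨ NS.solve 3 (λ x y z → x NS.:* y NS.:* z NS.:= y NS.:* (NS.con 1 NS.:* x NS.:* z)) refl
                 (notIn c (map (w +F_) L)) (notIn c L) (κ a b c) ⟩
          notIn c L * (1 * notIn c (map (w +F_) L) * κ a b c)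
            -- The factor 1 is `ε (w + c) c`: the points `c` and `d` differ because `w ≠ 0`.
            ≡⟨ cong₂ (λ x y → notIn c L * (x * y * κ a b c))
                 (sym (ε-≢ (absurd w≢0 (solve 2 (λ w c → w :+ :0 := w :+ c :+ c) refl w c)))) (sym (notIn-shift w c L)) ⟩
          notIn c L * (notIn (w +F c) (c ∷ L) * κ a b c) ∎
        values : ∑ (map (w +F_) L ++ L) (κ a b) ≡ 2 * quads a b
        values = trans
          (cong₂ _+_ (trans (κ-w+ a b b) (κ-b a b)) (cong₂ _+_ (trans (κ-w+ a b a) (κ-a a b))
          (cong₂ _+_ (trans (κ-w+ a b 1F) (κ-1 a b)) (cong₂ _+_ (trans (κ-w+ a b 0F) (κ-0 a b))
          (cong₂ _+_ (κ-b a b) (cong₂ _+_ (κ-a a b) (cong₂ _+_ (κ-1 a b) (cong (_+ 0) (κ-0 a b)))))))))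
          (NS.solve 4 (λ x y z t → x NS.:+ (y NS.:+ (z NS.:+ (t NS.:+ (x NS.:+ (y NS.:+ (z NS.:+ (t NS.:+ NS.con 0)))))))
            NS.:= NS.con 2 NS.:* (x NS.:+ (y NS.:+ (z NS.:+ t)))) refl
            (isFixed a) (isFixed b) (δ (B a b) 0F) (δ (B (1F +F a) (1F +F b)) 0F))

      private
        1≢0 : 1F ≢ 0F
        1≢0 eq = 0≢1 (sym eq)

      isFixed-0 : isFixed 0F ≡ 1
      isFixed-0 = δ-≡ φ-0

      isFixed-1 : isFixed 1F ≡ 1
      isFixed-1 = δ-≡ φ-1

      isFixed-1+ : ∀ a → isFixed (1F +F a) ≡ isFixed a
      isFixed-1+ a = δ-by-sum (trans (cong (_+F (1F +F a)) (trans (φ-+ 1F a) (cong (_+F φ a) φ-1)))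
        (solve 2 (λ a a' → :1 :+ a' :+ (:1 :+ a) := a' :+ a) refl a (φ a)))

      δ-B-0 : ∀ u v {s} → B u v ≡ s +F φ s → δ (B u v) 0F ≡ isFixed s
      δ-B-0 u v {s} eq = δ-by-sum (trans (+-identityʳ _) (trans eq (+-comm s (φ s))))

      -- Put `l = isFixed a`. The four special values of `b` contribute `Z l + 12`. Over the
      -- remaining `b` the summands of `quads` total `(Z − 4) l` and three times `2 − 2 l`, all
      -- counted twice. The loss is thus `24 + 3 Z l − 20 l`, its negative term being moved to the
      -- left.
      row-count : ∀ {a} → a ≢ 1F → a ≢ 0F →
        ∑ₑ (G a) + 20 * isFixed a ≡ ∑∉ (a ∷ 1F ∷ 0F ∷ []) (inner a) + 24 + 3 * Z * isFixed a
      row-count {a} a≢1 a≢0 = combine (∑∉ (a ∷ 1F ∷ 0F ∷ []) (inner a)) (isFixed a) Z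
          (∑ₑ (G a)) (∑∉ ps (λ _ → isFixed a)) (∑∉ ps isFixed) (∑∉ ps (λ b → δ (B a b) 0F)) (∑∉ ps (λ b → δ (B (1F +F a) (1F +F b)) 0F))
          total const fixed lines₀ lines₁
        where
        open ≡-Reasoning
        ps : List F
        ps = (1F +F a) ∷ a ∷ 1F ∷ 0F ∷ []
        1+a≢0 : 1F +F a ≢ 0F
        1+a≢0 eq = a≢1 (by-sum (solve 1 (λ a → a :+ :1 := :1 :+ a :+ :0) refl a) eq)
        unique₄ : Unique ps
        unique₄ =
          ( (λ eq → 1≢0 (by-sum (solve 1 (λ a → :1 :+ :0 := :1 :+ a :+ a) refl a) eq))
          ∷ (λ eq → a≢0 (by-sum (solve 1 (λ a → a :+ :0 := :1 :+ a :+ :1) refl a) eq))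
          ∷ 1+a≢0 ∷ [])
          ∷ (a≢1 ∷ a≢0 ∷ []) ∷ (1≢0 ∷ []) ∷ [] ∷ []
        -- The range of `b` in `extensions` includes `1 + a`, where `inner-good` does not apply; the
        -- term there is 0.
        drop : ∑∉ (a ∷ 1F ∷ 0F ∷ []) (inner a) ≡ ∑∉ ps (inner a)
        drop = ∑-cong elems λ b → step b (b ≟F (1F +F a))
          where
          step : ∀ b → Dec (b ≡ 1F +F a) →
            notIn b (a ∷ 1F ∷ 0F ∷ []) * inner a b ≡ ε b (1F +F a) * notIn b (a ∷ 1F ∷ 0F ∷ []) * inner a b
          step b (yes refl) = trans (trans (cong (notIn b (a ∷ 1F ∷ 0F ∷ []) *_) (inner-1+a a)) (ℕ.*-zeroʳ (notIn b (a ∷ 1F ∷ 0F ∷ []))))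
            (sym (trans (cong (ε b (1F +F a) * notIn b (a ∷ 1F ∷ 0F ∷ []) *_) (inner-1+a a)) (ℕ.*-zeroʳ (ε b (1F +F a) * notIn b (a ∷ 1F ∷ 0F ∷ [])))))
          step b (no b≢) = cong (_* inner a b) (sym (trans (cong (_* notIn b (a ∷ 1F ∷ 0F ∷ [])) (ε-≢ b≢)) (ℕ.*-identityˡ _)))
        total : ∑ₑ (G a) ≡ ∑∉ (a ∷ 1F ∷ 0F ∷ []) (inner a) +
          2 * (∑∉ ps (λ _ → isFixed a) + (∑∉ ps isFixed + (∑∉ ps (λ b → δ (B a b) 0F) + ∑∉ ps (λ b → δ (B (1F +F a) (1F +F b)) 0F))))
          + (Z * isFixed a + (4 + (4 + (4 + 0))))
        total = begin
          ∑ₑ (G a)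
            ≡⟨ ∑-delete unique₄ (G a) ⟩
          ∑∉ ps (G a) + (G a (1F +F a) + (G a a + (G a 1F + (G a 0F + 0))))
            ≡⟨ cong₂ _+_ (trans (∑∉-cong ps λ { b (b≢1+a ∷ b≢a ∷ b≢1 ∷ b≢0 ∷ []) →
                   inner-good a≢1 a≢0 b≢1+a b≢a b≢1 b≢0 }) (∑∉-+ ps (inner a) (λ b → 2 * quads a b)))
                 (cong₂ _+_ (G-a-1+a a) (cong₂ _+_ (G-a-a a) (cong₂ _+_ (G-a-1 a≢0) (cong (_+ 0) (G-a-0 a≢1))))) ⟩
          ∑∉ ps (inner a) + ∑∉ ps (λ b → 2 * quads a b) + (Z * isFixed a + (4 + (4 + (4 + 0))))
            ≡⟨ cong₂ (λ x y → x + y + (Z * isFixed a + (4 + (4 + (4 + 0))))) (sym drop)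
                 (trans (∑∉-*ˡ ps 2 (quads a)) (cong (2 *_) split)) ⟩
          _ ∎
          where
          split : ∑∉ ps (quads a) ≡
            ∑∉ ps (λ _ → isFixed a) + (∑∉ ps isFixed + (∑∉ ps (λ b → δ (B a b) 0F) + ∑∉ ps (λ b → δ (B (1F +F a) (1F +F b)) 0F)))
          split = trans (∑∉-+ ps (λ _ → isFixed a) _) (cong (∑∉ ps (λ _ → isFixed a) +_)
            (trans (∑∉-+ ps isFixed _) (cong (∑∉ ps isFixed +_) (∑∉-+ ps _ _))))
        const : Z * isFixed a ≡ ∑∉ ps (λ _ → isFixed a) + 4 * isFixed a
        const = trans (sym (∑-const elems (isFixed a))) (∑-delete unique₄ (λ _ → isFixed a))
        fixed : 4 ≡ ∑∉ ps isFixed + (isFixed a + (isFixed a + (1 + (1 + 0))))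
        fixed = trans (sym fix-count) (trans (∑-delete unique₄ isFixed) (cong (∑∉ ps isFixed +_)
          (cong₂ _+_ (isFixed-1+ a) (cong (isFixed a +_) (cong₂ _+_ isFixed-1 (cong (_+ 0) isFixed-0))))))
        -- Of the excluded points, `a` and 0 always lie in the kernel of `B a`, while 1 and `1 + a`
        -- do so exactly when `a` is fixed. `lines₁` treats the kernel of `B (1 + a)`, translated by
        -- 1.
        lines₀ : 4 ≡ ∑∉ ps (λ b → δ (B a b) 0F) + (isFixed a + (1 + (isFixed a + (1 + 0))))
        lines₀ = trans (sym (kernel-count a≢0)) (trans (∑-delete unique₄ _)
          (cong (∑∉ ps (λ b → δ (B a b) 0F) +_)
            (cong₂ _+_ (δ-B-0 a (1F +F a) v₁) (cong₂ _+_ (δ-≡ v₂) (cong₂ _+_ (δ-B-0 a 1F v₃) (cong (_+ 0) (δ-≡ v₄)))))))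
          where
          v₁ : B a (1F +F a) ≡ a +F φ a
          v₁ rewrite φ-+ 1F a | φ-1 = solve 2 (λ a a' → a' :* (:1 :+ a) :+ a :* (:1 :+ a') := a :+ a') refl a (φ a)
          v₂ : B a a ≡ 0F
          v₂ = solve 2 (λ a a' → a' :* a :+ a :* a' := :0) refl a (φ a)
          v₃ : B a 1F ≡ a +F φ a
          v₃ rewrite φ-1 = solve 2 (λ a a' → a' :* :1 :+ a :* :1 := a :+ a') refl a (φ a)
          v₄ : B a 0F ≡ 0F
          v₄ rewrite φ-0 = solve 2 (λ a a' → a' :* :0 :+ a :* :0 := :0) refl a (φ a)
        lines₁ : 4 ≡ ∑∉ ps (λ b → δ (B (1F +F a) (1F +F b)) 0F) + (isFixed a + (1 + (1 + (isFixed a + 0))))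
        lines₁ = trans (sym (trans (∑-shift 1F (λ b → δ (B (1F +F a) b) 0F)) (kernel-count 1+a≢0))) (trans (∑-delete unique₄ _)
          (cong (∑∉ ps (λ b → δ (B (1F +F a) (1F +F b)) 0F) +_)
            (cong₂ _+_ (δ-B-0 _ _ v₁) (cong₂ _+_ (δ-≡ v₂) (cong₂ _+_ (δ-≡ v₃) (cong (_+ 0) (δ-B-0 _ _ v₄)))))))
          where
          v₁ : B (1F +F a) (1F +F (1F +F a)) ≡ a +F φ a
          v₁ rewrite φ-+ 1F (1F +F a) | φ-+ 1F a | φ-1 = solve 2 (λ a a' →
            (:1 :+ a') :* (:1 :+ (:1 :+ a)) :+ (:1 :+ a) :* (:1 :+ (:1 :+ a')) := a :+ a') refl a (φ a)
          v₂ : B (1F +F a) (1F +F a) ≡ 0F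
          v₂ = solve 2 (λ a a' → a' :* a :+ a :* a' := :0) refl (1F +F a) (φ (1F +F a))
          v₃ : B (1F +F a) (1F +F 1F) ≡ 0F
          v₃ rewrite φ-+ 1F 1F | φ-1 = solve 2 (λ u u' → u' :* (:1 :+ :1) :+ u :* (:1 :+ :1) := :0) refl (1F +F a) (φ (1F +F a))
          v₄ : B (1F +F a) (1F +F 0F) ≡ a +F φ a
          v₄ rewrite φ-+ 1F 0F | φ-+ 1F a | φ-1 | φ-0 = solve 2 (λ a a' →
            (:1 :+ a') :* (:1 :+ :0) :+ (:1 :+ a) :* (:1 :+ :0) := a :+ a') refl a (φ a)
        combine : ∀ I l z g s₁ s₂ s₃ s₄ → g ≡ I + 2 * (s₁ + (s₂ + (s₃ + s₄))) + (z * l + 12) → z * l ≡ s₁ + 4 * l →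
          4 ≡ s₂ + (l + (l + 2)) → 4 ≡ s₃ + (l + (1 + (l + 1))) → 4 ≡ s₄ + (l + (1 + (1 + (l + 0)))) →
          g + 20 * l ≡ I + 24 + 3 * z * l
        combine I l z g s₁ s₂ s₃ s₄ eg e₁ e₂ e₃ e₄ = begin
          g + 20 * l
            ≡⟨ cong (_+ 20 * l) eg ⟩
          I + 2 * (s₁ + (s₂ + (s₃ + s₄))) + (z * l + 12) + 20 * l
            ≡⟨ NS.solve 7 (λ I l z s₁ s₂ s₃ s₄ →
                 I NS.:+ NS.con 2 NS.:* (s₁ NS.:+ (s₂ NS.:+ (s₃ NS.:+ s₄))) NS.:+ (z NS.:* l NS.:+ NS.con 12) NS.:+ NS.con 20 NS.:* l
                 NS.:= I NS.:+ NS.con 2 NS.:* ((s₁ NS.:+ NS.con 4 NS.:* l) NS.:+ ((s₂ NS.:+ (l NS.:+ (l NS.:+ NS.con 2)))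
                   NS.:+ ((s₃ NS.:+ (l NS.:+ (NS.con 1 NS.:+ (l NS.:+ NS.con 1)))) NS.:+ (s₄ NS.:+ (l NS.:+ (NS.con 1 NS.:+ (NS.con 1 NS.:+ (l NS.:+ NS.con 0))))))))
                   NS.:+ z NS.:* l) refl I l z s₁ s₂ s₃ s₄ ⟩
          I + 2 * ((s₁ + 4 * l) + ((s₂ + (l + (l + 2))) + ((s₃ + (l + (1 + (l + 1)))) + (s₄ + (l + (1 + (1 + (l + 0)))))))) + z * l
            ≡⟨ cong₂ (λ x y → I + 2 * (x + y) + z * l) (sym e₁) (cong₂ _+_ (sym e₂) (cong₂ _+_ (sym e₃) (sym e₄))) ⟩
          I + 2 * (z * l + 12) + z * l
            ≡⟨ NS.solve 3 (λ I l z → I NS.:+ NS.con 2 NS.:* (z NS.:* l NS.:+ NS.con 12) NS.:+ z NS.:* l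
                 NS.:= I NS.:+ NS.con 24 NS.:+ NS.con 3 NS.:* z NS.:* l) refl I l z ⟩
          I + 24 + 3 * z * l ∎

      -- The total is split by `a`. The rows `a = 0` and `a = 1` take away `5 Z − 4` each, every
      -- other row 24, and the two rows with `a` in Fix `φ` outside 0, 1 a further `3 Z − 20` each.
      -- Together this is `40 Z − 96`; adding `40 Z` to both sides keeps the arithmetic in ℕ.
      extensions-01 : extensions 4 (1F ∷ 0F ∷ []) ≡ Z * Z + 8 * Z + 96
      extensions-01 = ℕ.+-cancelʳ-≡ (40 * Z) _ _ (combine (extensions 4 ps) Z
          (∑∉ ps (λ a → ∑ₑ (G a))) (∑∉ ps (λ _ → 24)) (∑∉ ps isFixed) (∑ₑ (G 1F)) (∑ₑ (G 0F))
          rows const fixed all G-1 G-0)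
        where
        open ≡-Reasoning
        ps : List F
        ps = 1F ∷ 0F ∷ []
        unique₂ : Unique ps
        unique₂ = (1≢0 ∷ []) ∷ [] ∷ []
        rows : ∑∉ ps (λ a → ∑ₑ (G a)) + 20 * ∑∉ ps isFixed ≡ extensions 4 ps + ∑∉ ps (λ _ → 24) + 3 * Z * ∑∉ ps isFixed
        rows = begin
          ∑∉ ps (λ a → ∑ₑ (G a)) + 20 * ∑∉ ps isFixed
            ≡⟨ cong (∑∉ ps (λ a → ∑ₑ (G a)) +_) (sym (∑∉-*ˡ ps 20 isFixed)) ⟩
          ∑∉ ps (λ a → ∑ₑ (G a)) + ∑∉ ps (λ a → 20 * isFixed a)
            ≡⟨ sym (∑∉-+ ps _ _) ⟩
          ∑∉ ps (λ a → ∑ₑ (G a) + 20 * isFixed a)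
            ≡⟨ ∑∉-cong ps (λ { a (a≢1 ∷ a≢0 ∷ []) → row-count a≢1 a≢0 }) ⟩
          ∑∉ ps (λ a → ∑∉ (a ∷ ps) (inner a) + 24 + 3 * Z * isFixed a)
            ≡⟨ trans (∑∉-+ ps _ _) (cong₂ _+_ (∑∉-+ ps _ _) (∑∉-*ˡ ps (3 * Z) isFixed)) ⟩
          extensions 4 ps + ∑∉ ps (λ _ → 24) + 3 * Z * ∑∉ ps isFixed ∎
        const : Z * 24 ≡ ∑∉ ps (λ _ → 24) + 48
        const = trans (sym (∑-const elems 24)) (∑-delete unique₂ (λ _ → 24))
        fixed : ∑∉ ps isFixed ≡ 2
        fixed = ℕ.+-cancelʳ-≡ 2 _ _ (sym (trans (sym fix-count) (trans (∑-delete unique₂ isFixed)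
          (cong (∑∉ ps isFixed +_) (cong₂ _+_ isFixed-1 (cong (_+ 0) isFixed-0))))))
        all : Z * Z + 48 * Z ≡ ∑∉ ps (λ a → ∑ₑ (G a)) + (∑ₑ (G 1F) + (∑ₑ (G 0F) + 0))
        all = trans (sym total-count) (∑-delete unique₂ (λ a → ∑ₑ (G a)))
        combine : ∀ M z x t s g₁ g₀ → x + 20 * s ≡ M + t + 3 * z * s → z * 24 ≡ t + 48 → s ≡ 2 →
          z * z + 48 * z ≡ x + (g₁ + (g₀ + 0)) → g₁ + 4 ≡ 5 * z → g₀ + 4 ≡ 5 * z →
          M + 40 * z ≡ z * z + 8 * z + 96 + 40 * z
        combine M z x t s g₁ g₀ e₁ e₂ refl e₃ e₄ e₅ = begin
          M + 40 * z
            ≡⟨ NS.solve 2 (λ M z → M NS.:+ NS.con 40 NS.:* z NS.:= M NS.:+ z NS.:* NS.con 24 NS.:+ NS.con 3 NS.:* z NS.:* NS.con 2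
                 NS.:+ (NS.con 5 NS.:* z NS.:+ NS.con 5 NS.:* z)) refl M z ⟩
          M + z * 24 + 3 * z * 2 + (5 * z + 5 * z)
            ≡⟨ cong₂ (λ u v → M + u + 3 * z * 2 + v) e₂ (cong₂ _+_ (sym e₄) (sym e₅)) ⟩
          M + (t + 48) + 3 * z * 2 + ((g₁ + 4) + (g₀ + 4))
            ≡⟨ NS.solve 5 (λ M t z g₁ g₀ → M NS.:+ (t NS.:+ NS.con 48) NS.:+ NS.con 3 NS.:* z NS.:* NS.con 2 NS.:+ ((g₁ NS.:+ NS.con 4) NS.:+ (g₀ NS.:+ NS.con 4))
                 NS.:= (M NS.:+ t NS.:+ NS.con 3 NS.:* z NS.:* NS.con 2) NS.:+ (NS.con 56 NS.:+ g₁ NS.:+ g₀)) refl M t z g₁ g₀ ⟩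
          (M + t + 3 * z * 2) + (56 + g₁ + g₀)
            ≡⟨ cong (_+ (56 + g₁ + g₀)) (sym e₁) ⟩
          (x + 40) + (56 + g₁ + g₀)
            ≡⟨ NS.solve 3 (λ x g₁ g₀ → (x NS.:+ NS.con 40) NS.:+ (NS.con 56 NS.:+ g₁ NS.:+ g₀)
                 NS.:= x NS.:+ (g₁ NS.:+ (g₀ NS.:+ NS.con 0)) NS.:+ NS.con 96) refl x g₁ g₀ ⟩
          x + (g₁ + (g₀ + 0)) + 96
            ≡⟨ cong (_+ 96) (sym e₃) ⟩
          z * z + 48 * z + 96
            ≡⟨ NS.solve 1 (λ z → z NS.:* z NS.:+ NS.con 48 NS.:* z NS.:+ NS.con 96
                 NS.:= z NS.:* z NS.:+ NS.con 8 NS.:* z NS.:+ NS.con 96 NS.:+ NS.con 40 NS.:* z) refl z ⟩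
          z * z + 8 * z + 96 + 40 * z ∎

-- Primitive elements

module _ {m : ℕ} (K : GF2^ m) where
  open Field K

  module Primitive (α : F) (generates : IsPrimitive α)
    (n : ℕ) (2^m≡1+n : 2 ^ m ≡ suc n) (2≤n : 2 ≤ n) where

    private
      n≢0 : NonZero n
      n≢0 = >-nonZero (ℕ.≤-trans (s≤s z≤n) 2≤n)

      embedding⇒≤ : ∀ d (f : F → Fin (suc d)) (g : Fin (suc d) → F) → (∀ x → g (f x) ≡ x) → n ≤ d
      embedding⇒≤ d f g gf = s≤s⁻¹ (subst (_≤ suc d) 2^m≡1+n (Fin.injective⇒≤ {f = λ i → f (Inverse.from card i)} λ {i} {j} eq →
        trans (sym (Inverse.strictlyInverseˡ card i)) (trans (cong (Inverse.to card)
          (trans (sym (gf _)) (trans (cong g eq) (gf _)))) (Inverse.strictlyInverseˡ card j))))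

    -- The powers of 0 are only 1 and 0, so `F` would have at most two elements.
    α≢0 : α ≢ 0F
    α≢0 refl = ℕ.<⇒≱ 2≤n (embedding⇒≤ 1 f g gf)
      where
      f : F → Fin 2
      f x with x ≟F 0F
      ... | yes _ = zero
      ... | no _ = suc zero
      g : Fin 2 → F
      g zero = 0F
      g (suc _) = 1F
      gf : ∀ x → g (f x) ≡ x
      gf x with x ≟F 0F
      ... | yes x≡0 = sym x≡0
      ... | no x≢0 with generates x x≢0
      ...   | zero , eq = eq
      ...   | suc i , eq = contradiction (trans (sym eq) (zeroˡ _)) x≢0

    -- Index d is the parity coordinate.
    point : ℕ → ℕ → F
    point d i with i ℕ.<? d
    ... | yes _ = pow α i
    ... | no _ = 0F

    point-< : ∀ {d i} → i < d → point d i ≡ pow α i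
    point-< {d} {i} i<d with i ℕ.<? d
    ... | yes _ = refl
    ... | no i≮d = contradiction i<d i≮d

    point-≥ : ∀ d → point d d ≡ 0F
    point-≥ d with d ℕ.<? d
    ... | yes d<d = contradiction d<d (ℕ.<-irrefl refl)
    ... | no _ = refl

    pow-mod : ∀ d .{{_ : NonZero d}} → pow α d ≡ 1F → ∀ i → pow α (i % d) ≡ pow α i
    pow-mod d αᵈ≡1 i = sym (begin
      pow α i                                    ≡⟨ cong (pow α) (m≡m%n+[m/n]*n i d) ⟩
      pow α (i % d + i / d * d)                  ≡⟨ pow-+ α (i % d) (i / d * d) ⟩
      pow α (i % d) *F pow α (i / d * d)         ≡⟨ cong (pow α (i % d) *F_) (pow-* α (i / d) d) ⟩
      pow α (i % d) *F pow (pow α d) (i / d)     ≡⟨ cong (λ t → pow α (i % d) *F pow t (i / d)) αᵈ≡1 ⟩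
      pow α (i % d) *F pow 1F (i / d)            ≡⟨ cong (pow α (i % d) *F_) (pow-1F (i / d)) ⟩
      pow α (i % d) *F 1F                        ≡⟨ *-identityʳ _ ⟩
      pow α (i % d)                              ∎)
      where open ≡-Reasoning

    -- Any period `d` of `α` lists the field by 0 and `d` powers. For arbitrary `d` this bounds the
    -- order from below by `n`; for `d = n` it inverts the coordinate map.
    point-index : ∀ d .{{_ : NonZero d}} → pow α d ≡ 1F → ∀ x → ∃ λ k → k ≤ d × point d k ≡ x
    point-index d αᵈ≡1 x with x ≟F 0F
    ... | yes x≡0 = d , ℕ.≤-refl , trans (point-≥ d) (sym x≡0)
    ... | no x≢0 with generates x x≢0
    ...   | i , αⁱ≡x = i % d , ℕ.<⇒≤ (m%n<n i d) , trans (point-< (m%n<n i d)) (trans (pow-mod d αᵈ≡1 i) αⁱ≡x)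

    n≤order : ∀ d .{{_ : NonZero d}} → pow α d ≡ 1F → n ≤ d
    n≤order d αᵈ≡1 = embedding⇒≤ d
      (λ x → fromℕ< (s≤s (proj₁ (proj₂ (ix x)))))
      (λ i → point d (toℕ i))
      (λ x → trans (cong (point d) (Fin.toℕ-fromℕ< _)) (proj₂ (proj₂ (ix x))))
      where
      ix : ∀ x → ∃ λ k → k ≤ d × point d k ≡ x
      ix = point-index d αᵈ≡1

    pow-∸ : ∀ {i j} → i ≤ j → pow α i ≡ pow α j → pow α (j ∸ i) ≡ 1F
    pow-∸ {i} {j} i≤j eq = sym (*-cancelˡ (pow-nonzero i α≢0) (begin
      pow α i *F 1F               ≡⟨ *-identityʳ _ ⟩
      pow α i                     ≡⟨ eq ⟩
      pow α j                     ≡⟨ cong (pow α) (sym (ℕ.m+[n∸m]≡n i≤j)) ⟩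
      pow α (i + (j ∸ i))         ≡⟨ pow-+ α i (j ∸ i) ⟩
      pow α i *F pow α (j ∸ i)    ∎))
      where open ≡-Reasoning

    n≤gap : ∀ {i j} → i < j → pow α i ≡ pow α j → n ≤ j ∸ i
    n≤gap {i} {j} i<j eq = n≤order (j ∸ i) {{>-nonZero (ℕ.m<n⇒0<n∸m i<j)}} (pow-∸ (ℕ.<⇒≤ i<j) eq)

    -- The `n + 2` values 0, 1, `α`, ..., `α^n` cannot be distinct. Powers are nonzero, so two of
    -- them agree; their exponents differ by at least `n`, hence by exactly `n`.
    αⁿ≡1 : pow α n ≡ 1F
    αⁿ≡1 = from-collision (Fin.pigeonhole (ℕ.≤-reflexive (cong suc 2^m≡1+n)) (λ i → Inverse.to card (f i)))
      where
      f : Fin (suc (suc n)) → F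
      f zero = 0F
      f (suc i) = pow α (toℕ i)
      to-injective : ∀ {x y} → Inverse.to card x ≡ Inverse.to card y → x ≡ y
      to-injective {x} {y} eq = trans (sym (Inverse.strictlyInverseʳ card x))
        (trans (cong (Inverse.from card) eq) (Inverse.strictlyInverseʳ card y))
      from-collision : (∃₂ λ i j → i Fin.< j × Inverse.to card (f i) ≡ Inverse.to card (f j)) → pow α n ≡ 1F
      from-collision (zero , suc j , _ , eq) = contradiction (sym (to-injective eq)) (pow-nonzero (toℕ j) α≢0)
      from-collision (suc i , suc j , s≤s i<j , eq) = trans
        (cong (pow α) (ℕ.≤-antisym (n≤gap i<j (to-injective eq))
          (ℕ.≤-trans (ℕ.m∸n≤m (toℕ j) (toℕ i)) (s≤s⁻¹ (Fin.toℕ<n j)))))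
        (pow-∸ (ℕ.<⇒≤ i<j) (to-injective eq))

    pow-injective : ∀ {i j} → i < n → j < n → pow α i ≡ pow α j → i ≡ j
    pow-injective {i} {j} i<n j<n eq with ℕ.<-cmp i j
    ... | tri≈ _ i≡j _ = i≡j
    ... | tri< i<j _ _ = contradiction (n≤gap i<j eq) (ℕ.<⇒≱ (ℕ.≤-<-trans (ℕ.m∸n≤m j i) j<n))
    ... | tri> _ _ j<i = contradiction (n≤gap j<i (sym eq)) (ℕ.<⇒≱ (ℕ.≤-<-trans (ℕ.m∸n≤m i j) i<n))

    pow≡1⇒∣ : ∀ k → pow α k ≡ 1F → n ∣ k
    pow≡1⇒∣ k αᵏ≡1 = m%n≡0⇒n∣m k n {{n≢0}} (pow-injective (m%n<n k n {{n≢0}})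
      (ℕ.≤-trans (s≤s z≤n) 2≤n) (trans (pow-mod n {{n≢0}} αⁿ≡1 k) αᵏ≡1))

    pt : Fin (suc n) → F
    pt i = point n (toℕ i)

    private
      index : ∀ x → ∃ λ k → k ≤ n × point n k ≡ x
      index = point-index n {{n≢0}} αⁿ≡1

    ix : F → Fin (suc n)
    ix x = fromℕ< (s≤s (proj₁ (proj₂ (index x))))

    pt-ix : ∀ x → pt (ix x) ≡ x
    pt-ix x = trans (cong (point n) (Fin.toℕ-fromℕ< _)) (proj₂ (proj₂ (index x)))

    pt-injective : ∀ {i j} → pt i ≡ pt j → i ≡ j
    pt-injective {i} {j} eq = Fin.toℕ-injective (inj (s≤s⁻¹ (Fin.toℕ<n i)) (s≤s⁻¹ (Fin.toℕ<n j)) eq)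
      where
      inj : ∀ {a b} → a ≤ n → b ≤ n → point n a ≡ point n b → a ≡ b
      inj {a} {b} a≤n b≤n eq with ℕ.m≤n⇒m<n∨m≡n a≤n | ℕ.m≤n⇒m<n∨m≡n b≤n
      ... | inj₁ a<n | inj₁ b<n = pow-injective a<n b<n (trans (sym (point-< a<n)) (trans eq (point-< b<n)))
      ... | inj₂ a≡n | inj₂ b≡n = trans a≡n (sym b≡n)
      ... | inj₁ a<n | inj₂ refl = contradiction (trans (sym (point-< a<n)) (trans eq (point-≥ n))) (pow-nonzero a α≢0)
      ... | inj₂ refl | inj₁ b<n = contradiction (trans (sym (point-< b<n)) (trans (sym eq) (point-≥ n))) (pow-nonzero b α≢0)

    -- Listed in the order of the coordinates, so that summing over `F` is summing over the entries
    -- of an extended word.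
    elems : List F
    elems = tabulate pt

    elems-unique : Unique elems
    elems-unique = Unique.tabulate⁺ pt-injective

    elems-complete : ∀ x → x ∈ elems
    elems-complete x = subst (_∈ elems) (pt-ix x) (∈-tabulate⁺ {f = pt} (ix x))

    open Enumerated _≟F_ elems elems-unique elems-complete using (∑ₑ; δ; δ-≡; δ-≢; ∑∉; ∑∉-cong; ∑-delete; notIn)

    fermat : ∀ x → frob m x ≡ x
    fermat x = trans (frob-pow m x) (trans (cong (pow x) 2^m≡1+n) (xⁿ⁺¹≡x (x ≟F 0F)))
      where
      xⁿ⁺¹≡x : Dec (x ≡ 0F) → x *F pow x n ≡ x
      xⁿ⁺¹≡x (yes refl) = zeroˡ _
      xⁿ⁺¹≡x (no x≢0) with generates x x≢0
      ... | i , refl = trans (cong (pow α i *F_) (trans (pow-pow-comm α i n) (trans (cong (λ t → pow t i) αⁿ≡1) (pow-1F i))))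
        (*-identityʳ _)

    -- The roots of x^(d+1) = x are 0 and the d powers of α^(n/d).
    roots-count : ∀ d r .{{_ : NonZero d}} → n ≡ d * r → ∑ₑ (λ x → δ (pow x (suc d)) x) ≡ suc d
    roots-count d r n≡dr = begin
      ∑ₑ f                          ≡⟨ ∑-delete roots-unique f ⟩
      ∑∉ roots f + ∑ roots f        ≡⟨ cong₂ _+_ none (∑-ones roots roots-valid) ⟩
      length roots                  ≡⟨ cong suc (length-tabulate root) ⟩
      suc d                         ∎
      where
      open ≡-Reasoning
      f : F → ℕ
      f x = δ (pow x (suc d)) x
      root : Fin d → F
      root j = pow α (toℕ j * r)
      roots : List F
      roots = 0F ∷ tabulate root
      r≢0 : NonZero r
      r≢0 = ≢-nonZero λ { refl → contradiction (subst (2 ≤_) (trans n≡dr (ℕ.*-zeroʳ d)) 2≤n) λ () }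
      jr<n : ∀ (j : Fin d) → toℕ j * r < n
      jr<n j = subst (toℕ j * r <_) (sym n≡dr) (ℕ.*-monoˡ-< r {{r≢0}} (Fin.toℕ<n j))
      roots-unique : Unique roots
      roots-unique = All.tabulate⁺ (λ j eq → pow-nonzero (toℕ j * r) α≢0 (sym eq))
        ∷ Unique.tabulate⁺ (λ {i} {j} eq → Fin.toℕ-injective
            (ℕ.*-cancelʳ-≡ (toℕ i) (toℕ j) r {{r≢0}} (pow-injective (jr<n i) (jr<n j) eq)))
      root-valid : ∀ j → pow (root j) (suc d) ≡ root j
      root-valid j = trans (cong (root j *F_) (begin
        pow (pow α (toℕ j * r)) d     ≡⟨ sym (pow-* α d (toℕ j * r)) ⟩
        pow α (d * (toℕ j * r))       ≡⟨ cong (pow α) (trans (sym (ℕ.*-assoc d (toℕ j) r))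
                                           (trans (cong (_* r) (ℕ.*-comm d (toℕ j))) (ℕ.*-assoc (toℕ j) d r))) ⟩
        pow α (toℕ j * (d * r))       ≡⟨ cong (λ t → pow α (toℕ j * t)) (sym n≡dr) ⟩
        pow α (toℕ j * n)             ≡⟨ pow-* α (toℕ j) n ⟩
        pow (pow α n) (toℕ j)         ≡⟨ cong (λ t → pow t (toℕ j)) αⁿ≡1 ⟩
        pow 1F (toℕ j)                ≡⟨ pow-1F (toℕ j) ⟩
        1F                            ∎)) (*-identityʳ _)
      roots-valid : All (λ x → f x ≡ 1) roots
      roots-valid = δ-≡ (zeroˡ _) ∷ All.tabulate⁺ (λ j → δ-≡ (root-valid j))
      power-root : ∀ {k} → k < n → r ∣ k → pow α k ∈ roots
      power-root k<n (divides q refl) = there (subst (_∈ tabulate root)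
        (cong (λ t → pow α (t * r)) (Fin.toℕ-fromℕ< q<d)) (∈-tabulate⁺ {f = root} (fromℕ< q<d)))
        where
        q<d : q < d
        q<d = ℕ.*-cancelʳ-< r q d (subst (q * r <_) n≡dr k<n)
      is-root : ∀ {k} → k ≤ n → pow (point n k) (suc d) ≡ point n k → point n k ∈ roots
      is-root {k} k≤n eq with ℕ.m≤n⇒m<n∨m≡n k≤n
      ... | inj₂ refl = here (point-≥ n)
      -- Cancelling `α^k` leaves `α^(d k) = 1`, so `n = d r` divides `d k` and `r` divides `k`.
      ... | inj₁ k<n = subst (_∈ roots) (sym (point-< k<n)) (power-root k<n
              (*-cancelˡ-∣ {r} {k} d (subst (_∣ d * k) n≡dr (pow≡1⇒∣ (d * k) (trans (pow-* α d k)
                (*-cancelˡ (pow-nonzero k α≢0) (trans (subst (λ t → pow t (suc d) ≡ t) (point-< k<n) eq) (sym (*-identityʳ _)))))))))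
      none : ∑∉ roots f ≡ 0
      none = trans (∑∉-cong roots λ x x∉ → δ-≢ λ eq → All.All¬⇒¬Any x∉
          (subst (_∈ roots) (pt-ix x) (is-root (s≤s⁻¹ (Fin.toℕ<n (ix x))) (subst (λ t → pow t (suc d) ≡ t) (sym (pt-ix x)) eq))))
        (trans (∑-cong elems (λ x → ℕ.*-zeroʳ (notIn x roots))) (∑-zero elems))

    -- Bézout without negative numbers: one multiple equals the gcd plus the other. The latter is
    -- first applied to `x` at no cost.
    frob-gcd : ∀ i j {x} → frob i x ≡ x → frob j x ≡ x → frob (gcd i j) x ≡ x
    frob-gcd i j {x} fi fj with Bézout.identity (gcd-GCD i j)
    ... | Bézout.Identity.+- u v eq = begin
      frob (gcd i j) x                  ≡⟨ cong (frob (gcd i j)) (sym (frob-multiple v j fj)) ⟩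
      frob (gcd i j) (frob (v * j) x)   ≡⟨ frob-∘ (gcd i j) (v * j) x ⟩
      frob (gcd i j + v * j) x          ≡⟨ cong (λ t → frob t x) eq ⟩
      frob (u * i) x                    ≡⟨ frob-multiple u i fi ⟩
      x                                 ∎
      where open ≡-Reasoning
    ... | Bézout.Identity.-+ u v eq = begin
      frob (gcd i j) x                  ≡⟨ cong (frob (gcd i j)) (sym (frob-multiple u i fi)) ⟩
      frob (gcd i j) (frob (u * i) x)   ≡⟨ frob-∘ (gcd i j) (u * i) x ⟩
      frob (gcd i j + u * i) x          ≡⟨ cong (λ t → frob t x) eq ⟩
      frob (v * j) x                    ≡⟨ frob-multiple v j fj ⟩
      x                                 ∎
      where open ≡-Reasoning

-- The design

subsets : ∀ n → List (Subset n)
subsets zero = [] ∷ []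
subsets (suc n) = map (true ∷_) (subsets n) ++ map (false ∷_) (subsets n)

subsets-complete : ∀ {n} (S : Subset n) → S ∈ subsets n
subsets-complete [] = here refl
subsets-complete (true ∷ S) = ∈-++⁺ˡ (∈-map⁺ (true ∷_) (subsets-complete S))
subsets-complete (false ∷ S) = ∈-++⁺ʳ _ (∈-map⁺ (false ∷_) (subsets-complete S))

subsets-unique : ∀ n → Unique (subsets n)
subsets-unique zero = [] ∷ []
subsets-unique (suc n) = Unique.++⁺ (Unique.map⁺ ∷-injectiveʳ (subsets-unique n)) (Unique.map⁺ ∷-injectiveʳ (subsets-unique n))
  λ (t∈ , f∈) → disjoint (∈-map⁻ (true ∷_) t∈) (∈-map⁻ (false ∷_) f∈)
  where
  disjoint : ∀ {S} → (∃ λ T → T ∈ subsets n × S ≡ true ∷ T) → ¬ (∃ λ T → T ∈ subsets n × S ≡ false ∷ T)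
  disjoint (_ , _ , refl) (_ , _ , ())

indicator : ∀ {n} → Subset n → Fin n → ℕ
indicator S i = if lookup S i then 1 else 0

⟦∈?⟧ : ∀ {n} (i : Fin n) S → ⟦ i ∈ₛ? S ⟧ ≡ indicator S i
⟦∈?⟧ i S with lookup S i in eq
... | true = ⟦⟧-yes (i ∈ₛ? S) (lookup⇒[]= i S eq)
... | false = ⟦⟧-no (i ∈ₛ? S) λ i∈S → contradiction (trans (sym eq) ([]=⇒lookup i∈S)) λ ()

∑-indicator : ∀ {n} {A : Set} (S : Subset n) (f : Fin n → A) (g : A → ℕ) →
  (∀ i → g (f i) ≡ indicator S i) → ∑ (tabulate f) g ≡ ∣ S ∣
∑-indicator [] f g eq = refl
∑-indicator (true ∷ S) f g eq = cong₂ _+_ (eq zero) (∑-indicator S (λ i → f (suc i)) g (λ i → eq (suc i)))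
∑-indicator (false ∷ S) f g eq = cong₂ _+_ (eq zero) (∑-indicator S (λ i → f (suc i)) g (λ i → eq (suc i)))

∣∣-insert : ∀ {n} (S : Subset n) i → lookup S i ≡ false → ∣ S [ i ]≔ true ∣ ≡ suc ∣ S ∣
∣∣-insert (false ∷ S) zero _ = refl
∣∣-insert (true ∷ S) (suc i) eq = cong suc (∣∣-insert S i eq)
∣∣-insert (false ∷ S) (suc i) eq = ∣∣-insert S i eq

odd : ℕ → Bool
odd zero = false
odd (suc k) = not (odd k)

parity-weight : ∀ {n} (v : Vec Bool n) → parity v ≡ odd ∣ v ∣
parity-weight [] = refl
parity-weight (true ∷ v) = cong not (parity-weight v)
parity-weight (false ∷ v) = parity-weight v

parity-∷ʳ : ∀ {n} (v : Vec Bool n) b → parity (v ∷ʳ b) ≡ parity v xor b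
parity-∷ʳ [] b = Bool.xor-identityʳ b
parity-∷ʳ (a ∷ v) b = trans (cong (a xor_) (parity-∷ʳ v b)) (sym (Bool.xor-assoc a (parity v) b))

xor≡false⇒≡ : ∀ a b → a xor b ≡ false → a ≡ b
xor≡false⇒≡ false false _ = refl
xor≡false⇒≡ true true _ = refl

module _ {m : ℕ} (K : GF2^ m) where
  open Field K

  module Blocks (α : F) (generates : IsPrimitive α)
    (n : ℕ) (2^m≡1+n : 2 ^ m ≡ suc n) (2≤n : 2 ≤ n) (e : ℕ) (e≤m : e ≤ m) where

    open Primitive K α generates n 2^m≡1+n 2≤n

    φ : F → F
    φ = frob e

    private
      φ⁻¹-φ : ∀ x → frob (m ∸ e) (frob e x) ≡ x
      φ⁻¹-φ x = trans (frob-∘ (m ∸ e) e x) (trans (cong (λ t → frob t x) (ℕ.m∸n+n≡m e≤m)) (fermat x))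

    open Sextuples K elems elems-unique elems-complete φ (frob (m ∸ e)) (frob-+F e) (frob-*F e)
      φ⁻¹-φ (λ x → trans (frob-comm e (m ∸ e) x) (φ⁻¹-φ x))

    Z≡2^m : Z ≡ 2 ^ m
    Z≡2^m = trans (length-tabulate pt) (sym 2^m≡1+n)

    ix-pt : ∀ i → ix (pt i) ≡ i
    ix-pt i = pt-injective (pt-ix (pt i))

    ix-injective : ∀ {x y} → ix x ≡ ix y → x ≡ y
    ix-injective {x} {y} eq = trans (sym (pt-ix x)) (trans (cong pt eq) (pt-ix y))

    -- Double counting of words of weight 6 through given points.

    SumsVanish : Subset (suc n) → Set
    SumsVanish S = fsum (point n) S ≡ 0F × fsum (λ i → Q (point n i)) S ≡ 0F

    -- A decidable stand-in for the block condition, which asks for a polynomial cofactor; it allows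
    -- the blocks to be listed by a filter.
    IsWord : Subset (suc n) → Set
    IsWord S = ∣ S ∣ ≡ 6 × SumsVanish S

    isWord? : Decidable IsWord
    isWord? S = (∣ S ∣ ℕ.≟ 6) ×-dec ((fsum (point n) S ≟F 0F) ×-dec (fsum (λ i → Q (point n i)) S ≟F 0F))

    blocks : List (Subset (suc n))
    blocks = filter isWord? (subsets (suc n))

    mem : F → Subset (suc n) → ℕ
    mem x S = indicator S (ix x)

    contains : List F → Subset (suc n) → ℕ
    contains [] S = 1
    contains (p ∷ ps) S = mem p S * contains ps S

    Contains : List F → Subset (suc n) → Set
    Contains ps S = All (λ p → lookup S (ix p) ≡ true) ps

    contains-view : ∀ ps S → Contains ps S ⊎ contains ps S ≡ 0
    contains-view [] S = inj₁ []
    contains-view (p ∷ ps) S with lookup S (ix p) in eq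
    ... | false = inj₂ refl
    ... | true with contains-view ps S
    ...   | inj₁ all = inj₁ (eq ∷ all)
    ...   | inj₂ z = inj₂ (trans (ℕ.+-identityʳ _) z)

    Contains⇒contains : ∀ {ps S} → Contains ps S → contains ps S ≡ 1
    Contains⇒contains [] = refl
    Contains⇒contains (eq ∷ eqs) = cong₂ _*_ (cong (if_then 1 else 0) eq) (Contains⇒contains eqs)

    ∑-mem : ∀ S → ∑ₑ (λ x → mem x S) ≡ ∣ S ∣
    ∑-mem S = ∑-indicator S pt (λ x → mem x S) (λ i → cong (indicator S) (ix-pt i))

    -- If `S` contains `ps`, exactly `k` of its points are left to choose; otherwise both sides are
    -- 0.
    ∑∉-contains : ∀ {k ps} S → Unique ps → ∣ S ∣ ≡ k + length ps →
      ∑∉ ps (λ x → contains (x ∷ ps) S) ≡ k * contains ps S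
    ∑∉-contains {k} {ps} S u size = begin
      ∑∉ ps (λ x → mem x S * contains ps S)
        ≡⟨ ∑∉-cong ps (λ x _ → ℕ.*-comm (mem x S) (contains ps S)) ⟩
      ∑∉ ps (λ x → contains ps S * mem x S)
        ≡⟨ ∑∉-*ˡ ps (contains ps S) (λ x → mem x S) ⟩
      contains ps S * ∑∉ ps (λ x → mem x S)
        ≡⟨ count (contains-view ps S) ⟩
      contains ps S * k
        ≡⟨ ℕ.*-comm (contains ps S) k ⟩
      k * contains ps S ∎
      where
      open ≡-Reasoning
      count : Contains ps S ⊎ contains ps S ≡ 0 → contains ps S * ∑∉ ps (λ x → mem x S) ≡ contains ps S * k
      count (inj₂ z) rewrite z = refl
      count (inj₁ all) = cong (contains ps S *_) (ℕ.+-cancelʳ-≡ (length ps) _ _ (begin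
        ∑∉ ps (λ x → mem x S) + length ps
          ≡⟨ cong (∑∉ ps (λ x → mem x S) +_) (sym (∑-ones ps (All.map (cong (if_then 1 else 0)) all))) ⟩
        ∑∉ ps (λ x → mem x S) + ∑ ps (λ x → mem x S)
          ≡⟨ sym (∑-delete u (λ x → mem x S)) ⟩
        ∑ₑ (λ x → mem x S)
          ≡⟨ ∑-mem S ⟩
        ∣ S ∣
          ≡⟨ size ⟩
        k + length ps ∎))

    blocks-through : List F → ℕ
    blocks-through ps = ∑ blocks (contains ps)

    ∑∉-blocks-through : ∀ {k ps} → Unique ps → k + length ps ≡ 6 →
      ∑∉ ps (λ x → blocks-through (x ∷ ps)) ≡ k * blocks-through ps
    ∑∉-blocks-through {k} {ps} u size = begin
      ∑ₑ (λ x → notIn x ps * ∑ blocks (contains (x ∷ ps)))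
        ≡⟨ ∑-cong elems (λ x → sym (∑-*ˡ blocks (notIn x ps) _)) ⟩
      ∑ₑ (λ x → ∑ blocks (λ S → notIn x ps * contains (x ∷ ps) S))
        ≡⟨ ∑-swap elems blocks _ ⟩
      ∑ blocks (λ S → ∑∉ ps (λ x → contains (x ∷ ps) S))
        ≡⟨ ∑-cong-All (All.map (λ { {S} (∣S∣≡6 , _) → ∑∉-contains S u (trans ∣S∣≡6 (sym size)) })
             (All.all-filter isWord? (subsets (suc n)))) ⟩
      ∑ blocks (λ S → k * contains ps S)
        ≡⟨ ∑-*ˡ blocks k (contains ps) ⟩
      k * blocks-through ps ∎
      where open ≡-Reasoning

    setOf : List F → Subset (suc n)
    setOf [] = replicate (suc n) false
    setOf (p ∷ ps) = setOf ps [ ix p ]≔ true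

    lookup-setOf-∉ : ∀ {p ps} → All (p ≢_) ps → lookup (setOf ps) (ix p) ≡ false
    lookup-setOf-∉ {p} [] = lookup-replicate (ix p) false
    lookup-setOf-∉ {p} {q ∷ ps} (p≢q ∷ p∉) =
      trans (lookup∘update′ (λ eq → p≢q (ix-injective eq)) (setOf ps) true) (lookup-setOf-∉ p∉)

    Contains-insert : ∀ {ps} S i → Contains ps S → Contains ps (S [ i ]≔ true)
    Contains-insert S i = All.map λ {p} eq → insert p eq
      where
      insert : ∀ p → lookup S (ix p) ≡ true → lookup (S [ i ]≔ true) (ix p) ≡ true
      insert p eq with ix p Fin.≟ i
      ... | yes refl = lookup∘update i S true
      ... | no ≢i = trans (lookup∘update′ ≢i S true) eq

    Contains-setOf : ∀ ps → Contains ps (setOf ps)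
    Contains-setOf [] = []
    Contains-setOf (p ∷ ps) = lookup∘update (ix p) (setOf ps) true ∷ Contains-insert (setOf ps) (ix p) (Contains-setOf ps)

    ∣setOf∣ : ∀ {ps} → Unique ps → ∣ setOf ps ∣ ≡ length ps
    ∣setOf∣ [] = ∣⊥∣≡0 (suc n)
    ∣setOf∣ {p ∷ ps} (p∉ ∷ u) = trans (∣∣-insert (setOf ps) (ix p) (lookup-setOf-∉ p∉)) (cong suc (∣setOf∣ u))

    fsum-insert : ∀ {k} w (S : Subset k) i → lookup S i ≡ false → fsum w (S [ i ]≔ true) ≡ w (toℕ i) +F fsum w S
    fsum-insert w (false ∷ S) zero _ = solve 2 (λ x s → :1 :* x :+ s := x :+ (:0 :* x :+ s)) refl (w 0) _
    fsum-insert w (b ∷ S) (suc i) eq = trans (cong (bit b *F w 0 +F_) (fsum-insert (λ i → w (suc i)) S i eq))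
      (solve 3 (λ a x s → a :+ (x :+ s) := x :+ (a :+ s)) refl (bit b *F w 0) (w (suc (toℕ i))) _)

    fsum-setOf : ∀ {ps} → Unique ps → fsum (point n) (setOf ps) ≡ Σ₁ ps
    fsum-setOf [] = fsum-false (suc n) (point n)
    fsum-setOf {p ∷ ps} (p∉ ∷ u) = trans (fsum-insert (point n) (setOf ps) (ix p) (lookup-setOf-∉ p∉))
      (cong₂ _+F_ (pt-ix p) (fsum-setOf u))

    fsumQ-setOf : ∀ {ps} → Unique ps → fsum (λ i → Q (point n i)) (setOf ps) ≡ ΣQ ps
    fsumQ-setOf [] = fsum-false (suc n) (λ i → Q (point n i))
    fsumQ-setOf {p ∷ ps} (p∉ ∷ u) = trans (fsum-insert (λ i → Q (point n i)) (setOf ps) (ix p) (lookup-setOf-∉ p∉))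
      (cong₂ _+F_ (cong Q (pt-ix p)) (fsumQ-setOf u))

    ∣∣≡0⇒empty : ∀ {k} (S : Subset k) → ∣ S ∣ ≡ 0 → S ≡ replicate k false
    ∣∣≡0⇒empty [] _ = refl
    ∣∣≡0⇒empty (false ∷ S) eq = cong (false ∷_) (∣∣≡0⇒empty S eq)

    Contains⇒≡setOf : ∀ {ps} S → Unique ps → Contains ps S → ∣ S ∣ ≡ length ps → S ≡ setOf ps
    Contains⇒≡setOf S [] [] size = ∣∣≡0⇒empty S size
    Contains⇒≡setOf {p ∷ ps} S (p∉ ∷ u) (p∈S ∷ ps∈S) size = begin
      S                                 ≡⟨ sym reinsert ⟩
      S′ [ ix p ]≔ true                 ≡⟨ cong (_[ ix p ]≔ true) (Contains⇒≡setOf S′ u ps∈S′ size′) ⟩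
      setOf (p ∷ ps)                    ∎
      where
      open ≡-Reasoning
      S′ : Subset (suc n)
      S′ = S [ ix p ]≔ false
      reinsert : S′ [ ix p ]≔ true ≡ S
      reinsert = trans ([]≔-idempotent S (ix p)) (trans (cong (S [ ix p ]≔_) (sym p∈S)) ([]≔-lookup S (ix p)))
      ps∈S′ : Contains ps S′
      ps∈S′ = All.zipWith (λ (p≢q , q∈S) → trans (lookup∘update′ (λ eq → p≢q (sym (ix-injective eq))) S false) q∈S) (p∉ , ps∈S)
      size′ : ∣ S′ ∣ ≡ length ps
      size′ = ℕ.suc-injective (trans (sym (∣∣-insert S′ (ix p) (lookup∘update (ix p) S false))) (trans (cong ∣_∣ reinsert) size))

    -- The only 6-set through six distinct points is `setOf ps`, so the count is the indicator that
    -- this set is a word.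
    blocks-through-six : ∀ {ps} → Unique ps → length ps ≡ 6 → blocks-through ps ≡ code ps
    blocks-through-six {ps} u size = begin
      ∑ blocks (contains ps)
        ≡⟨ ∑-filter isWord? (contains ps) (subsets (suc n)) ⟩
      ∑ (subsets (suc n)) (λ S → ⟦ isWord? S ⟧ * contains ps S)
        ≡⟨ ∑-cong (subsets (suc n)) (λ S → only-setOf S (S ≟S setOf ps)) ⟩
      ∑ (subsets (suc n)) (λ S → ⟦ S ≟S setOf ps ⟧ * code ps)
        ≡⟨ Enumerated.∑-δ _≟S_ (subsets (suc n)) (subsets-unique (suc n)) subsets-complete (setOf ps) (λ _ → code ps) ⟩
      code ps ∎
      where
      open ≡-Reasoning
      _≟S_ : DecidableEquality (Subset (suc n))
      _≟S_ = ≡-dec Bool._≟_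
      only-setOf : ∀ S → (dec : Dec (S ≡ setOf ps)) → ⟦ isWord? S ⟧ * contains ps S ≡ ⟦ dec ⟧ * code ps
      only-setOf S (yes refl) = begin
        ⟦ isWord? S ⟧ * contains ps S
          ≡⟨ cong (⟦ isWord? S ⟧ *_) (Contains⇒contains (Contains-setOf ps)) ⟩
        ⟦ isWord? S ⟧ * 1
          ≡⟨ ℕ.*-identityʳ _ ⟩
        ⟦ isWord? S ⟧
          ≡⟨ trans (⟦×-dec⟧ (∣ S ∣ ℕ.≟ 6) _) (cong₂ _*_ (⟦⟧-yes (∣ S ∣ ℕ.≟ 6) (trans (∣setOf∣ u) size)) (⟦×-dec⟧ (_ ≟F 0F) (_ ≟F 0F))) ⟩
        1 * (δ (fsum (point n) (setOf ps)) 0F * δ (fsum (λ i → Q (point n i)) (setOf ps)) 0F)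
          ≡⟨ cong₂ (λ s t → 1 * (δ s 0F * δ t 0F)) (fsum-setOf u) (fsumQ-setOf u) ⟩
        1 * code ps ∎
      only-setOf S (no S≢) with contains-view ps S
      ... | inj₂ z = trans (cong (⟦ isWord? S ⟧ *_) z) (ℕ.*-zeroʳ ⟦ isWord? S ⟧)
      ... | inj₁ all = cong (_* contains ps S) (⟦⟧-no (isWord? S) λ (∣S∣≡6 , _) →
              S≢ (Contains⇒≡setOf S u all (trans ∣S∣≡6 (sym size))))

    -- The remaining `k` points of a block can be added in `k !` orders; for `k = 4` this is the
    -- factor 24.
    extensions-blocks : ∀ k {ps} → Unique ps → k + length ps ≡ 6 → k ! * blocks-through ps ≡ extensions k ps
    extensions-blocks zero {ps} u size = trans (ℕ.*-identityˡ _) (blocks-through-six u size)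
    extensions-blocks (suc k) {ps} u size = begin
      suc k * k ! * blocks-through ps
        ≡⟨ trans (cong (_* blocks-through ps) (ℕ.*-comm (suc k) (k !))) (ℕ.*-assoc (k !) (suc k) _) ⟩
      k ! * (suc k * blocks-through ps)
        ≡⟨ cong (k ! *_) (sym (∑∉-blocks-through u size)) ⟩
      k ! * ∑∉ ps (λ x → blocks-through (x ∷ ps))
        ≡⟨ sym (∑∉-*ˡ ps (k !) _) ⟩
      ∑∉ ps (λ x → k ! * blocks-through (x ∷ ps))
        ≡⟨ ∑∉-cong ps (λ x x∉ → extensions-blocks k (x∉ ∷ u) (trans (ℕ.+-suc k (length ps)) size)) ⟩
      extensions (suc k) ps ∎
      where open ≡-Reasoning

    -- Fixed fields, and the number of blocks through a pair.

    module _ (gcd≡2 : gcd m e ≡ 2) (r : ℕ) (n≡15r : n ≡ 15 * r) where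

      private
        2∣e : 2 ∣ e
        2∣e = subst (_∣ e) gcd≡2 (gcd[m,n]∣n m e)

        frob-even : ∀ k {x} → 2 ∣ e → frob (2 * k) x ≡ x → frob (e * k) x ≡ x
        frob-even k {x} (divides q refl) eq =
          trans (cong (λ t → frob t x) (ℕ.*-assoc q 2 k)) (frob-multiple q (2 * k) eq)

        n≡3[5r] : n ≡ 3 * (5 * r)
        n≡3[5r] = trans n≡15r (ℕ.*-assoc 3 5 r)

      -- An `x` fixed by `frob e` is fixed by `frob m` as well, hence by `frob 2`; conversely `e` is
      -- even. So Fix `φ` consists of the roots of x^4 = x.
      fix-count : ∑ₑ (λ x → δ (φ x) x) ≡ 4
      fix-count = trans (∑-cong elems λ x → δ-cong (fwd x) (bwd x)) (roots-count 3 (5 * r) n≡3[5r])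
        where
        fwd : ∀ x → φ x ≡ x → pow x 4 ≡ x
        fwd x eq = trans (sym (frob-pow 2 x)) (subst (λ d → frob d x ≡ x) gcd≡2 (frob-gcd m e (fermat x) eq))
        bwd : ∀ x → pow x 4 ≡ x → φ x ≡ x
        bwd x eq = trans (cong (λ t → frob t x) (sym (ℕ.*-identityʳ e))) (frob-even 1 2∣e (trans (frob-pow 2 x) eq))

      -- Every `x` is fixed by `frob m` and so by `frob (2 m)`; the doubled exponent gives
      -- `gcd (2 m) (2 e) = 2 · gcd m e = 4` at once. All 16 roots of x^16 = x lie in `F` because 15
      -- divides `n`.
      fix²-count : ∑ₑ (λ x → δ (φ (φ x)) x) ≡ 16
      fix²-count = trans (∑-cong elems λ x → δ-cong (fwd x) (bwd x)) (roots-count 15 r n≡15r)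
        where
        e+e≡2e : e + e ≡ 2 * e
        e+e≡2e = cong (e +_) (sym (ℕ.+-identityʳ e))
        φφ : ∀ x → φ (φ x) ≡ frob (2 * e) x
        φφ x = trans (frob-∘ e e x) (cong (λ t → frob t x) e+e≡2e)
        gcd≡4 : gcd (2 * m) (2 * e) ≡ 4
        gcd≡4 = trans (sym (c*gcd[m,n]≡gcd[cm,cn] 2 m e)) (cong (2 *_) gcd≡2)
        fwd : ∀ x → φ (φ x) ≡ x → pow x 16 ≡ x
        fwd x eq = trans (sym (frob-pow 4 x)) (subst (λ d → frob d x ≡ x) gcd≡4
          (frob-gcd (2 * m) (2 * e) (frob-multiple 2 m (fermat x)) (trans (sym (φφ x)) eq)))
        bwd : ∀ x → pow x 16 ≡ x → φ (φ x) ≡ x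
        bwd x eq = trans (φφ x) (trans (cong (λ t → frob t x) (ℕ.*-comm 2 e)) (frob-even 2 2∣e (trans (frob-pow 4 x) eq)))

      open Count fix-count fix²-count using (extensions-01)

      blocks-through-pair : ∀ {x y} → x ≢ y → 24 * blocks-through (y ∷ x ∷ []) ≡ 2 ^ m * 2 ^ m + 8 * 2 ^ m + 96
      blocks-through-pair {x} {y} x≢y = begin
        24 * blocks-through (y ∷ x ∷ [])
          ≡⟨ extensions-blocks 4 (((λ eq → x≢y (sym eq)) ∷ []) ∷ [] ∷ []) refl ⟩
        extensions 4 (y ∷ x ∷ [])
          ≡⟨ cong₂ (λ u v → extensions 4 (u ∷ v ∷ []))
               -- With scale factor `x + y`, the affine map sends 0 to `x` and 1 to `y`.
               (solve 2 (λ x y → y := x :+ (x :+ y) :* :1) refl x y) (solve 2 (λ x y → x := x :+ (x :+ y) :* :0) refl x y) ⟩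
        extensions 4 (map (Affine.T x (x +F y) d≢0) (1F ∷ 0F ∷ []))
          ≡⟨ Affine.extensions-T x (x +F y) d≢0 4 (1F ∷ 0F ∷ [])
               (λ { (_ ∷ _ ∷ _ ∷ _ ∷ _ ∷ _ ∷ []) refl →
                 solve 0 (:1 :+ (:1 :+ (:1 :+ (:1 :+ (:1 :+ (:1 :+ :0))))) := :0) refl }) ⟩
        extensions 4 (1F ∷ 0F ∷ [])
          ≡⟨ extensions-01 ⟩
        Z * Z + 8 * Z + 96
          ≡⟨ cong (λ z → z * z + 8 * z + 96) Z≡2^m ⟩
        2 ^ m * 2 ^ m + 8 * 2 ^ m + 96 ∎
        where
        open ≡-Reasoning
        d≢0 : x +F y ≢ 0F
        d≢0 eq = x≢y (by-sum (sym (+-identityʳ _)) eq)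

      -- Words of weight 6 as supports of codewords.

      module _ (p₁ p₂ g : Poly) (min₁ : IsMinPoly K α p₁) (min₂ : IsMinPoly K (pow α (1 + 2 ^ e)) p₂)
        (lcm : IsLcm p₁ p₂ g) where

        IsBlock : Subset (suc n) → Set
        IsBlock = SupportsOfWeight 6 (Extended n (CyclicCode n g))

        private
          n≢0 : NonZero n
          n≢0 = >-nonZero (ℕ.≤-trans (s≤s z≤n) 2≤n)

          Q-pow : ∀ i → Q (pow α i) ≡ pow (pow α (1 + 2 ^ e)) i
          Q-pow i = trans (cong (_*F pow α i) (frob-pow e (pow α i)))
            (trans (*-comm _ _) (pow-pow-comm α i (1 + 2 ^ e)))

          -- The parity coordinate sits at the point 0 and adds nothing to the linear sum; as
          -- `Q 0 = 0`, the same holds for the quadratic one.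
          fsum-extended : ∀ (c : Vec Bool n) b → fsum (point n) (c ∷ʳ b) ≡ fsum (pow α) c
          fsum-extended c b = trans (fsum-∷ʳ (point n) c b) (trans
            (cong₂ (λ s t → s +F bit b *F t) (fsum-cong (λ i i<n → point-< i<n) c) (point-≥ n))
            (solve 2 (λ s b → s :+ b :* :0 := s) refl _ (bit b)))

          fsumQ-extended : ∀ (c : Vec Bool n) b →
            fsum (λ i → Q (point n i)) (c ∷ʳ b) ≡ fsum (pow (pow α (1 + 2 ^ e))) c
          fsumQ-extended c b = trans (fsum-∷ʳ _ c b) (trans
            (cong₂ (λ s t → s +F bit b *F t) (fsum-cong (λ i i<n → trans (cong Q (point-< i<n)) (Q-pow i)) c)
              (trans (cong Q (point-≥ n)) (zeroʳ _)))
            (solve 2 (λ s b → s :+ b :* :0 := s) refl _ (bit b)))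

        block⇒word : ∀ {S} → IsBlock S → IsWord S
        block⇒word (_ , (c , c∈C , refl) , weight≡6 , refl) = weight≡6 ,
          trans (fsum-extended c (parity c))
            (codeword⇒roots n {{n≢0}} α p₁ g αⁿ≡1 (proj₁ (proj₂ min₁)) (proj₁ (proj₂ lcm)) c c∈C) ,
          trans (fsumQ-extended c (parity c))
            (codeword⇒roots n {{n≢0}} (pow α (1 + 2 ^ e)) p₂ g
              (trans (pow-pow-comm α (1 + 2 ^ e) n) (trans (cong (λ t → pow t (1 + 2 ^ e)) αⁿ≡1) (pow-1F (1 + 2 ^ e))))
              (proj₁ (proj₂ min₂)) (proj₁ (proj₂ (proj₂ lcm))) c c∈C)

        word⇒block : ∀ {S} → IsWord S → IsBlock S
        word⇒block {S} (∣S∣≡6 , z₁ , z₂) with initLast S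
        ... | c , b , refl = S ,
          (c , roots⇒codeword n α (pow α (1 + 2 ^ e)) p₁ p₂ g min₁ min₂ lcm c
                 (trans (sym (fsum-extended c b)) z₁) (trans (sym (fsumQ-extended c b)) z₂) ,
           -- The weight 6 is even, which forces the last entry to be the parity of the others.
           cong (c ∷ʳ_) (xor≡false⇒≡ (parity c) b (trans (sym (parity-∷ʳ c b)) (trans (parity-weight (c ∷ʳ b)) (cong odd ∣S∣≡6))))) ,
          ∣S∣≡6 , refl

        -- The value of `lam` enters through its characterisation by `24 * k`, which keeps the
        -- divisions of the closed formula out of the combinatorics.
        design : ∀ lam → (∀ k → 24 * k ≡ 2 ^ m * 2 ^ m + 8 * 2 ^ m + 96 → k ≡ lam) → Is2Design (suc n) 6 lam IsBlock
        design lam count≡lam = record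
          { blocks = blocks
          ; unique = Unique.filter⁺ isWord? (subsets-unique (suc n))
          ; complete = λ S → mk⇔ (λ S∈ → word⇒block (proj₂ (∈-filter⁻ isWord? {xs = subsets (suc n)} S∈)))
                                 (λ b → ∈-filter⁺ isWord? (subsets-complete S) (block⇒word b))
          ; blockSize = λ S b → proj₁ (block⇒word b)
          ; balanced = λ x y x≢y → trans (trans (length-filter-∑ _ blocks) (∑-cong blocks (through x y)))
              (count≡lam _ (blocks-through-pair (λ eq → x≢y (pt-injective eq))))
          }
          where
          through : ∀ x y S → ⟦ (x ∈ₛ? S) ×-dec (y ∈ₛ? S) ⟧ ≡ contains (pt y ∷ pt x ∷ []) S
          through x y S = trans (⟦×-dec⟧ (x ∈ₛ? S) (y ∈ₛ? S)) (trans (cong₂ _*_ (⟦∈?⟧ x S) (⟦∈?⟧ y S))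
            (trans (ℕ.*-comm (indicator S x) (indicator S y)) (cong₂ _*_ (cong (indicator S) (sym (ix-pt y)))
              (trans (cong (indicator S) (sym (ix-pt x))) (sym (ℕ.*-identityʳ _))))))

-- By `16 (1 + 15 q) = 1 + 15 (1 + 16 q)`. The quotient is written `suc r` to show that it is
-- positive, which later gives `2 ≤ n`.
2^[4k] : ∀ k → ∃ λ r → 2 ^ (suc k * 4) ≡ suc (15 * suc r)
2^[4k] zero = 0 , refl
2^[4k] (suc k) with 2^[4k] k
... | r , eq = 16 * suc r , trans (ℕ.^-distribˡ-+-* 2 4 (suc k * 4)) (trans (cong (16 *_) eq)
  (solve 1 (λ r → con 16 :* (con 1 :+ con 15 :* (con 1 :+ r)) := con 1 :+ con 15 :* (con 1 :+ con 16 :* (con 1 :+ r))) refl r))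
  where open +-*-Solver

theorem3p9 : (m e : ℕ) → 1 ≤ m → m % 4 ≡ 0 → 2 ≤ e → e ≤ m / 2 → gcd m e ≡ 2 →
    (K : GF2^ m) → (α : GF2^.F K) → GF2^.IsPrimitive K α →
    (p₁ p₂ g : List _) →
    IsMinPoly K α p₁ →
    IsMinPoly K (GF2^.pow K α (1 + 2 ^ e)) p₂ →
    IsLcm p₁ p₂ g →
    Is2Design (1 + (2 ^ m ∸ 1)) 6 ((2 ^ (2 * m ∸ 3) + 2 ^ m + 12) / 3)
    (SupportsOfWeight 6 (Extended (2 ^ m ∸ 1) (CyclicCode (2 ^ m ∸ 1) g)))
theorem3p9 m e 1≤m m%4≡0 _ e≤m/2 gcd≡2 K α α-primitive p₁ p₂ g min₁ min₂ lcm =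
  Blocks.design K α α-primitive (2 ^ m ∸ 1) 2^m≡1+n 2≤n e (ℕ.≤-trans e≤m/2 (m/n≤m m 2)) gcd≡2 (suc r) n≡15r
    p₁ p₂ g min₁ min₂ lcm _ count≡lam
  where
  open ≡-Reasoning
  open +-*-Solver
  m≡4k : m ≡ m / 4 * 4
  m≡4k = trans (m≡m%n+[m/n]*n m 4) (cong (_+ m / 4 * 4) m%4≡0)
  quarter : ∀ q → m ≡ q * 4 → ∃ λ k → m ≡ suc k * 4
  quarter zero refl = contradiction 1≤m λ ()
  quarter (suc k) eq = k , eq
  k r : ℕ
  k = proj₁ (quarter (m / 4) m≡4k)
  m≡4[1+k] : m ≡ suc k * 4
  m≡4[1+k] = proj₂ (quarter (m / 4) m≡4k)
  r = proj₁ (2^[4k] k)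
  2^m≡1+15r : 2 ^ m ≡ suc (15 * suc r)
  2^m≡1+15r = trans (cong (2 ^_) m≡4[1+k]) (proj₂ (2^[4k] k))
  n≡15r : 2 ^ m ∸ 1 ≡ 15 * suc r
  n≡15r = cong (_∸ 1) 2^m≡1+15r
  2^m≡1+n : 2 ^ m ≡ suc (2 ^ m ∸ 1)
  2^m≡1+n = trans 2^m≡1+15r (cong suc (sym n≡15r))
  2≤n : 2 ≤ 2 ^ m ∸ 1
  2≤n = subst (2 ≤_) (sym n≡15r) (ℕ.≤-trans (s≤s (s≤s z≤n)) (ℕ.m≤m*n 15 (suc r)))
  -- Makes the truncated subtraction in the exponent `2 * m ∸ 3` exact.
  3≤2m : 3 ≤ 2 * m
  3≤2m = ℕ.≤-trans (s≤s (s≤s (s≤s z≤n))) (ℕ.*-monoʳ-≤ 2 (subst (4 ≤_) (sym m≡4[1+k]) (ℕ.m≤m+n 4 (k * 4))))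
  square : 2 ^ m * 2 ^ m ≡ 8 * 2 ^ (2 * m ∸ 3)
  square = begin
    2 ^ m * 2 ^ m              ≡⟨ sym (ℕ.^-distribˡ-+-* 2 m m) ⟩
    2 ^ (m + m)                ≡⟨ cong (λ t → 2 ^ (m + t)) (sym (ℕ.+-identityʳ m)) ⟩
    2 ^ (2 * m)                ≡⟨ cong (2 ^_) (sym (ℕ.m+[n∸m]≡n 3≤2m)) ⟩
    2 ^ (3 + (2 * m ∸ 3))      ≡⟨ ℕ.^-distribˡ-+-* 2 3 (2 * m ∸ 3) ⟩
    8 * 2 ^ (2 * m ∸ 3)        ∎
  count≡lam : ∀ c → 24 * c ≡ 2 ^ m * 2 ^ m + 8 * 2 ^ m + 96 → c ≡ (2 ^ (2 * m ∸ 3) + 2 ^ m + 12) / 3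
  count≡lam c eq = sym (trans (cong (_/ 3) (sym 3c≡)) (m*n/n≡m c 3))
    where
    3c≡ : c * 3 ≡ 2 ^ (2 * m ∸ 3) + 2 ^ m + 12
    3c≡ = ℕ.*-cancelˡ-≡ (c * 3) _ 8 (begin
      8 * (c * 3)
        ≡⟨ solve 1 (λ c → con 8 :* (c :* con 3) := con 24 :* c) refl c ⟩
      24 * c
        ≡⟨ eq ⟩
      2 ^ m * 2 ^ m + 8 * 2 ^ m + 96
        ≡⟨ cong (λ t → t + 8 * 2 ^ m + 96) square ⟩
      8 * 2 ^ (2 * m ∸ 3) + 8 * 2 ^ m + 96
        ≡⟨ solve 2 (λ s z → con 8 :* s :+ con 8 :* z :+ con 96 := con 8 :* (s :+ z :+ con 12)) refl (2 ^ (2 * m ∸ 3)) (2 ^ m) ⟩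
      8 * (2 ^ (2 * m ∸ 3) + 2 ^ m + 12) ∎)
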